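{- Let $\xi\in\mathbb{T}$, $\alpha,\beta\in\mathbf{DIG}^{\omega}$, $r_1,r_2\in\mathbb{R}$, and let $p$ be a proof that $P_q(\xi,\alpha,\beta)$ holds. If $\mathsf{rep}(\alpha,r_1)$ and $\mathsf{rep}(\beta,r_2)$ hold, then $\mathsf{rep}(\bar q(\xi,\alpha,\beta,p),\xi(r_1,r_2))$ holds.
   Context: Quadratic maps. $\mathbb{T}=\mathbb{Q}^8$ is the set of rational tensors $\xi=\left[\begin{smallmatrix} a & b & c & d \\ e & f & g & h \end{smallmatrix}\right]$, acting by $\xi(x,y)=\frac{axy+bx+cy+d}{exy+fx+gy+h}$. $\xi$ is bounded if its denominator does not vanish on $[-1,1]\times[-1,1]$. For a rational matrix (Möbius map) $\mu=\left[\begin{smallmatrix} p & q \\ r & s \end{smallmatrix}\right]$, $\mu(x)=\frac{px+q}{rx+s}$, the composition $\mu\circ\xi$ is the product of $\mu$ with the $2\times4$ matrix $\xi$ (it represents $\mu(\xi(x,y))$); $\xi\bullet_1\mu$ is the tensor representing $\xi(\mu(x),y)$, in which each row $(a,b,c,d)$ of $\xi$ is replaced by $(ap+cr,\,bp+dr,\,aq+cs,\,bq+ds)$; $\xi\bullet_2\mu$ is the tensor representing $\xi(x,\mu(y))$, in which each row $(a,b,c,d)$ is replaced by $(ap+br,\,aq+bs,\,cp+dr,\,cq+ds)$. $\phi^{ -1}$ is the matrix inverse. Digits. $\mathbf{DIG}=\{\mathbf L,\mathbf R,\mathbf M\}$, interpreted as the matrices $\mathbf L=\left[\begin{smallmatrix}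 1/2 & -1/2 \\ 1/2 & 3/2 \end{smallmatrix}\right]$, $\mathbf R=\left[\begin{smallmatrix} 1/2 & 1/2 \\ -1/2 & 3/2 \end{smallmatrix}\right]$, $\mathbf M=\left[\begin{smallmatrix} 1 & 0 \\ 0 & 3 \end{smallmatrix}\right]$. $\mathbf{DIG}^{\omega}$ is the (coinductive) type of infinite streams over $\mathbf{DIG}$, with constructor $\mathsf{Cons}$, head $\mathsf{hd}$ and tail $\mathsf{tl}$; $\cong$ is bisimilarity (equality of all entries). For $\xi\in\mathbb{T}$, $\phi\in\mathbf{DIG}$, the decidable emission condition $\mathbf{Incl}(\xi,\phi)$ means: $\xi$ is bounded and $\xi([-1,1]\times[-1,1])\subseteq\phi([-1,1])$. Quadratic algorithm. $E_q(\xi,\alpha,\beta)$ is the inductively defined (least) predicate with rules: if $\mathbf{Incl}(\xi,\phi)$ for some $\phi\in\mathbf{DIG}$ then $E_q(\xi,\alpha,\beta)$ (one rule per digit); if $E_q((\xi\bullet_1\mathsf{hd}(\alpha))\bullet_2\mathsf{hd}(\beta),\mathsf{tl}(\alpha),\mathsf{tl}(\beta))$ then $E_q(\xi,\alpha,\beta)$. For a proof $t$ of $E_q(\xi,\alpha,\beta)$, the quadruple $\overline m_q(\xi,\alpha,\beta,t)\in\mathbf{DIG}\times\mathbb{T}\times\mathbf{DIG}^{\omega}\times\mathbf{DIG}^{\omega}$ is defined by structural recursion on $t$: it is $(\mathbf L,\mathbf L^{ -1}\circ\xi,\alpha,\beta)$ if $\mathbf{Incl}(\xi,\mathbf L)$;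 else $(\mathbf R,\mathbf R^{ -1}\circ\xi,\alpha,\beta)$ if $\mathbf{Incl}(\xi,\mathbf R)$; else $(\mathbf M,\mathbf M^{ -1}\circ\xi,\alpha,\beta)$ if $\mathbf{Incl}(\xi,\mathbf M)$; otherwise $\overline m_q((\xi\bullet_1\mathsf{hd}(\alpha))\bullet_2\mathsf{hd}(\beta),\mathsf{tl}(\alpha),\mathsf{tl}(\beta),t')$ with $t'$ obtained from $t$ by inversion. $\Psi_q(n,\xi,\alpha,\beta)$ ($n\in\mathbb{N}$) is the inductive predicate with rules: $E_q(\xi,\alpha,\beta)$ implies $\Psi_q(0,\xi,\alpha,\beta)$; for a proof $t$ of $E_q(\xi,\alpha,\beta)$ with $\overline m_q(\xi,\alpha,\beta,t)=(\phi,\xi',\alpha',\beta')$, $\Psi_q(n,\xi',\alpha',\beta')$ implies $\Psi_q(n+1,\xi,\alpha,\beta)$. The productivity predicate is $P_q(\xi,\alpha,\beta):\Leftrightarrow\forall n\in\mathbb{N},\ \Psi_q(n,\xi,\alpha,\beta)$. $P_q(\xi,\alpha,\beta)$ implies $E_q(\xi,\alpha,\beta)$, and implies $P_q(\xi',\alpha',\beta')$ whenever $\overline m_q(\xi,\alpha,\beta,t)=(\phi,\xi',\alpha',\beta')$. For a proof $p$ of $P_q(\xi,\alpha,\beta)$, with $t$ the induced proof of $E_q(\xi,\alpha,\beta)$, $\overline m_q(\xi,\alpha,\beta,t)=(\phi,\xi',\alpha',\beta')$ and $p'$ the induced proof of $P_q(\xi',\alpha',\beta')$, the stream $\bar q(\xi,\alpha,\beta,p)\in\mathbf{DIG}^{\omega}$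 is defined corecursively by $\bar q(\xi,\alpha,\beta,p)=\mathsf{Cons}\ \phi\ \bar q(\xi',\alpha',\beta',p')$. Representation. $\mathsf{rep}\subseteq\mathbf{DIG}^{\omega}\times\mathbb{R}$ is the coinductively defined (greatest) relation generated by the three rules: whenever $-1\le r\le 1$ and $\mathsf{rep}(\alpha,r)$, then $\mathsf{rep}(\beta,\frac{r-1}{r+3})$ if $\beta\cong\mathsf{Cons}\ \mathbf L\ \alpha$; $\mathsf{rep}(\beta,\frac{r+1}{ -r+3})$ if $\beta\cong\mathsf{Cons}\ \mathbf R\ \alpha$; $\mathsf{rep}(\beta,\frac r3)$ if $\beta\cong\mathsf{Cons}\ \mathbf M\ \alpha$. (That is, the greatest relation such that every related pair arises as the conclusion of one of these rules from a related pair.) -}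

module Defs where

open import Level using (Level; _⊔_; suc)
open import Algebra.Apartness.Bundles using (HeytingField)
open import Algebra.Bundles using (CommutativeRing; RawRing)
open import Algebra.Morphism.Structures using (module RingMorphisms)
open import Data.Empty using (⊥-elim)
open import Data.Integer.Base using (+_)
open import Data.Maybe.Base using (Maybe; just; nothing)
open import Data.Nat.Base using (ℕ; zero; _≥_) renaming (suc to 1+_)
open import Data.Product.Base using (Σ-syntax; ∃-syntax; _×_; _,_; proj₁; proj₂)
open import Data.Rational.Base as Rat using (ℚ; 0ℚ; 1ℚ; ½; -½)
import Data.Rational.Properties as RatP
open import Data.Sum.Base using (_⊎_; inj₁; inj₂)
open import Relation.Binary.Core using (Rel)
open import Relation.Binary.Definitions using (Tri; tri<; tri≈; tri>)
open import Relation.Binary.PropositionalEquality.Core as ≡ using (_≡_; _≢_; _≗_)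
open import Relation.Binary.Structures using (IsStrictPartialOrder)
open import Relation.Nullary.Decidable.Core using (Dec; yes; no; from-yes; _×-dec_; _⊎-dec_; map′)
open import Relation.Nullary.Negation.Core using (¬_; contradiction)
open import Relation.Unary using (Pred)
open import Data.Rational.Solver using (module +-*-Solver)
open +-*-Solver using ()
  renaming (solve to solveℚ; con to conℚ; _:+_ to _:+ℚ_; _:*_ to _:*ℚ_; :-_ to :-ℚ_; _:-_ to _:-ℚ_; _:=_ to _:=ℚ_)
import Algebra.Solver.Ring as RingSolver
import Algebra.Solver.Ring.AlmostCommutativeRing as ACR
import Algebra.Apartness.Properties.HeytingCommutativeRing as HeytingProperties

-- The reals are axiomatised as a Cauchy complete Archimedean ordered Heyting
-- field.  Classically x # y is ¬ (x ≈ y), < is total, and these axioms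
-- characterise ℝ up to isomorphism.  The embedding ι of ℚ is determined by the
-- other components; it is a field only for convenience.

record RealNumbers (c ℓ₁ ℓ₂ : Level) : Set (suc (c ⊔ ℓ₁ ⊔ ℓ₂)) where
  field
    heytingField : HeytingField c ℓ₁ ℓ₂

  open HeytingField heytingField public

  infix 4 _<_ _≤_

  field
    _<_                  : Rel Carrier ℓ₂
    isStrictPartialOrder : IsStrictPartialOrder _≈_ _<_
    <⇒#                  : ∀ {x y} → x < y → x # y
    #⇒<⊎>                : ∀ {x y} → x # y → x < y ⊎ y < x
    +-monoˡ-<            : ∀ z {x y} → x < y → x + z < y + z
    *-pos                : ∀ {x y} → 0# < x → 0# < y → 0# < x * y

  _≤_ : Rel Carrier ℓ₂
  x ≤ y = ¬ (y < x)

  rawRing : RawRing c ℓ₁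
  rawRing = CommutativeRing.rawRing (record { isCommutativeRing = isCommutativeRing })

  open RingMorphisms RatP.+-*-rawRing rawRing using (IsRingHomomorphism)

  field
    ι                    : ℚ → Carrier
    ι-isRingHomomorphism : IsRingHomomorphism ι
    ι-mono-<             : ∀ {p q} → p Rat.< q → ι p < ι q
    archimedean          : ∀ x → ∃[ n ] x < ι (+ n Rat./ 1)

  Cauchy : (ℕ → Carrier) → Set (c ⊔ ℓ₂)
  Cauchy s = ∀ ε → 0# < ε → ∃[ N ] (∀ m n → m ≥ N → n ≥ N → s m < s n + ε)

  _⟶_ : (ℕ → Carrier) → Carrier → Set (c ⊔ ℓ₂)
  s ⟶ x = ∀ ε → 0# < ε → ∃[ N ] (∀ n → n ≥ N → s n < x + ε × x < s n + ε)

  field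
    complete : ∀ s → Cauchy s → ∃[ x ] s ⟶ x

  infix 7 _/_⟨_⟩

  _/_⟨_⟩ : (x y : Carrier) → y # 0# → Carrier
  x / y ⟨ y#0 ⟩ = x * proj₁ (#⇒invertible y#0)

record Möbius : Set where
  constructor möbius
  field p q r s : ℚ

-- The bilinear form a x y + b x + c y + d.
record Row : Set where
  constructor row
  field a b c d : ℚ

record Tensor : Set where
  constructor tensor
  field num den : Row

module _ where
  open Rat using (_+_; _*_; -_; _-_)

  infixr 9 _∘_
  infixl 8 _•₁_ _•₂_

  lin : ℚ → Row → ℚ → Row → Row
  lin k (row a b c d) l (row a′ b′ c′ d′) =
    row (k * a + l * a′) (k * b + l * b′) (k * c + l * c′) (k * d + l * d′)

  _∘_ : Möbius → Tensor → Tensor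
  möbius p q r s ∘ tensor n d = tensor (lin p n q d) (lin r n s d)

  _•₁_ : Tensor → Möbius → Tensor
  tensor n d •₁ möbius p q r s = tensor (sub n) (sub d)
    where
    sub : Row → Row
    sub (row a b c d) = row (a * p + c * r) (b * p + d * r) (a * q + c * s) (b * q + d * s)

  _•₂_ : Tensor → Möbius → Tensor
  tensor n d •₂ möbius p q r s = tensor (sub n) (sub d)
    where
    sub : Row → Row
    sub (row a b c d) = row (a * p + b * r) (a * q + b * s) (c * p + d * r) (c * q + d * s)

  det : Möbius → ℚ
  det (möbius p q r s) = p * s - q * r

  inverse : (μ : Möbius) .{{_ : Rat.NonZero (det μ)}} → Möbius
  inverse μ@(möbius p q r s) = möbius (k * s) (k * (- q)) (k * (- r)) (k * p)
    where
    k = Rat.1/ det μ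

data Digit : Set where
  𝐋 𝐑 𝐌 : Digit

⟦_⟧ : Digit → Möbius
⟦ 𝐋 ⟧ = möbius ½ -½ ½ (+ 3 Rat./ 2)
⟦ 𝐑 ⟧ = möbius ½ ½ -½ (+ 3 Rat./ 2)
⟦ 𝐌 ⟧ = möbius 1ℚ 0ℚ 0ℚ (+ 3 Rat./ 1)

⟦_⟧⁻¹ : Digit → Möbius
⟦ 𝐋 ⟧⁻¹ = inverse ⟦ 𝐋 ⟧
⟦ 𝐑 ⟧⁻¹ = inverse ⟦ 𝐑 ⟧
⟦ 𝐌 ⟧⁻¹ = inverse ⟦ 𝐌 ⟧

-- ℕ → Digit, with hd and tl, is the final coalgebra of Digit × _ up to its
-- bisimilarity, equality of all entries; corecursion into it is recursion on
-- the index.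

Digit^ω : Set
Digit^ω = ℕ → Digit

hd : Digit^ω → Digit
hd α = α 0

tl : Digit^ω → Digit^ω
tl α n = α (1+ n)

Cons : Digit → Digit^ω → Digit^ω
Cons φ α zero   = φ
Cons φ α (1+ n) = α n

infix 4 _≅_

_≅_ : Digit^ω → Digit^ω → Set
_≅_ = _≗_


module Exact {c ℓ₁ ℓ₂ : Level} (ℝ : RealNumbers c ℓ₁ ℓ₂) where

  open RealNumbers ℝ

  _∈[-1,1] : Pred Carrier ℓ₂
  x ∈[-1,1] = - 1# ≤ x × x ≤ 1#

  ⟪_⟫ : Row → Carrier → Carrier → Carrier
  ⟪ row a b c d ⟫ x y = ι a * x * y + ι b * x + ι c * y + ι d

  numerator denominator : Tensor → Carrier → Carrier → Carrier
  numerator   ξ = ⟪ Tensor.num ξ ⟫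
  denominator ξ = ⟪ Tensor.den ξ ⟫

  apply : (ξ : Tensor) (x y : Carrier) → denominator ξ x y # 0# → Carrier
  apply ξ x y nz = numerator ξ x y / denominator ξ x y ⟨ nz ⟩

  numeratorₘ denominatorₘ : Möbius → Carrier → Carrier
  numeratorₘ   (möbius p q r s) x = ι p * x + ι q
  denominatorₘ (möbius p q r s) x = ι r * x + ι s

  applyₘ : (μ : Möbius) (x : Carrier) → denominatorₘ μ x # 0# → Carrier
  applyₘ μ x nz = numeratorₘ μ x / denominatorₘ μ x ⟨ nz ⟩

  Bounded : Tensor → Set (c ⊔ ℓ₂)
  Bounded ξ = ∀ {x y} → x ∈[-1,1] → y ∈[-1,1] → denominator ξ x y # 0#

  _∈Image_ : Carrier → Möbius → Set (c ⊔ ℓ₁ ⊔ ℓ₂)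
  w ∈Image μ = ∃[ z ] z ∈[-1,1] × Σ[ nz ∈ denominatorₘ μ z # 0# ] w ≈ applyₘ μ z nz

  Incl : Tensor → Digit → Set (c ⊔ ℓ₁ ⊔ ℓ₂)
  Incl ξ φ = Σ[ bounded ∈ Bounded ξ ]
    (∀ {x y} (x∈ : x ∈[-1,1]) (y∈ : y ∈[-1,1]) → apply ξ x y (bounded x∈ y∈) ∈Image ⟦ φ ⟧)

  commutativeRing : CommutativeRing c ℓ₁
  commutativeRing = record { isCommutativeRing = isCommutativeRing }

  open RingMorphisms.IsRingHomomorphism ι-isRingHomomorphism
    using (+-homo; *-homo; -‿homo; 0#-homo; 1#-homo)
    renaming (⟦⟧-cong to ι-cong)
  open IsStrictPartialOrder isStrictPartialOrder
    using (<-respˡ-≈; <-respʳ-≈) renaming (irrefl to <-irrefl; trans to <-trans)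
  open HeytingProperties (HeytingField.heytingCommutativeRing heytingField)
    using (invertibleˡ⇒#; x-0≈x; x#0y#0→xy#0; #-congʳ)

  private
    morphism : RatP.+-*-rawRing ACR.-Raw-AlmostCommutative⟶ ACR.fromCommutativeRing commutativeRing
    morphism = record
      { ⟦_⟧ = ι ; +-homo = +-homo ; *-homo = *-homo ; -‿homo = -‿homo
      ; 0-homo = 0#-homo ; 1-homo = 1#-homo }

    ι-≟ : ∀ p q → Maybe (ι p ≈ ι q)
    ι-≟ p q with p RatP.≟ q
    ... | yes p≡q = just (ι-cong p≡q)
    ... | no _    = nothing

  module Solver = RingSolver RatP.+-*-rawRing (ACR.fromCommutativeRing commutativeRing) morphism ι-≟
  open Solver using (solve; con; _:+_; _:*_; :-_; _:-_; _:=_)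

  opaque

    <-cotrans : ∀ {x y} → x < y → ∀ z → x < z ⊎ z < y
    <-cotrans x<y z with #-cotrans (<⇒# x<y) z
    ... | inj₁ x#z with #⇒<⊎> x#z
    ...   | inj₁ x<z = inj₁ x<z
    ...   | inj₂ z<x = inj₂ (<-trans z<x x<y)
    <-cotrans x<y z | inj₂ z#y with #⇒<⊎> z#y
    ...   | inj₁ z<y = inj₂ z<y
    ...   | inj₂ y<z = inj₁ (<-trans x<y y<z)

    <-resp₂ : ∀ {x x′ y y′} → x ≈ x′ → y ≈ y′ → x < y → x′ < y′
    <-resp₂ p q = λ x<y → <-respˡ-≈ p (<-respʳ-≈ q x<y)

    ≤-resp₂ : ∀ {x x′ y y′} → x ≈ x′ → y ≈ y′ → x ≤ y → x′ ≤ y′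
    ≤-resp₂ p q x≤y y′<x′ = x≤y (<-resp₂ (sym q) (sym p) y′<x′)

    <⇒≤ : ∀ {x y} → x < y → x ≤ y
    <⇒≤ x<y y<x = <-irrefl refl (<-trans x<y y<x)

    x<y⇒0<y-x : ∀ {x y} → x < y → 0# < y - x
    x<y⇒0<y-x {x} x<y = <-respˡ-≈ (-‿inverseʳ x) (+-monoˡ-< (- x) x<y)

    0<y-x⇒x<y : ∀ {x y} → 0# < y - x → x < y
    0<y-x⇒x<y {x} {y} 0<y-x = <-resp₂ (+-identityˡ x)
      (solve 2 (λ x y → (y :- x) :+ x := y) refl x y) (+-monoˡ-< x 0<y-x)

    x≤y⇒0≤y-x : ∀ {x y} → x ≤ y → 0# ≤ y - x
    x≤y⇒0≤y-x {x} {y} x≤y y-x<0 = x≤y (<-resp₂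
      (solve 2 (λ x y → (y :- x) :+ x := y) refl x y) (+-identityˡ x) (+-monoˡ-< x y-x<0))

    0≤y-x⇒x≤y : ∀ {x y} → 0# ≤ y - x → x ≤ y
    0≤y-x⇒x≤y {x} 0≤y-x y<x = 0≤y-x (<-respʳ-≈ (-‿inverseʳ x) (+-monoˡ-< (- x) y<x))

    x<0⇒0<-x : ∀ {x} → x < 0# → 0# < - x
    x<0⇒0<-x {x} x<0 = <-respʳ-≈ (+-identityˡ (- x)) (x<y⇒0<y-x x<0)

    +-nonneg : ∀ {x y} → 0# ≤ x → 0# ≤ y → 0# ≤ x + y
    +-nonneg {x} {y} 0≤x 0≤y x+y<0 with <-cotrans x+y<0 y
    ... | inj₂ y<0   = 0≤y y<0
    ... | inj₁ x+y<y = 0≤x (<-resp₂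
      (solve 2 (λ x y → (x :+ y) :- y := x) refl x y) (-‿inverseʳ y) (+-monoˡ-< (- y) x+y<y))

    +-pos-nonneg : ∀ {x y} → 0# < x → 0# ≤ y → 0# < x + y
    +-pos-nonneg {x} {y} 0<x 0≤y with <-cotrans (<-respˡ-≈ (+-identityˡ y) (+-monoˡ-< y 0<x)) 0#
    ... | inj₁ y<0   = contradiction y<0 0≤y
    ... | inj₂ 0<x+y = 0<x+y

    xy#0⇒x#0 : ∀ {x y} → x * y # 0# → x # 0#
    xy#0⇒x#0 {x} {y} xy#0 with #⇒invertible xy#0
    ... | (v , v*xy≈1 , _) = invertibleˡ⇒# (v * y , trans (*-congˡ (x-0≈x x)) (trans
          (solve 3 (λ v x y → v :* y :* x := v :* (x :* y)) refl v x y)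
          (trans (*-congˡ (sym (x-0≈x (x * y)))) v*xy≈1)))

    xy#0⇒y#0 : ∀ {x y} → x * y # 0# → y # 0#
    xy#0⇒y#0 {x} {y} xy#0 = xy#0⇒x#0 (#-congʳ (*-comm x y) xy#0)

    x*-y≈0-xy : ∀ x y → x * - y ≈ 0# - x * y
    x*-y≈0-xy x y = trans (solve 2 (λ x y → x :* (:- y) := :- (x :* y)) refl x y) (sym (+-identityˡ (- (x * y))))

  opaque

    pos*neg : ∀ {x y} → 0# < x → y < 0# → x * y < 0#
    pos*neg {x} {y} 0<x y<0 = 0<y-x⇒x<y (<-respʳ-≈ (x*-y≈0-xy x y) (*-pos 0<x (x<0⇒0<-x y<0)))

    *-nonneg : ∀ {x y} → 0# ≤ x → 0# ≤ y → 0# ≤ x * y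
    *-nonneg {x} {y} 0≤x 0≤y xy<0 with #⇒<⊎> (xy#0⇒x#0 (<⇒# xy<0)) | #⇒<⊎> (xy#0⇒y#0 (<⇒# xy<0))
    ... | inj₁ x<0 | _        = 0≤x x<0
    ... | inj₂ _   | inj₁ y<0 = 0≤y y<0
    ... | inj₂ 0<x | inj₂ 0<y = <⇒≤ (*-pos 0<x 0<y) xy<0

    *-cancelˡ-nonneg : ∀ {x y} → 0# < x → 0# ≤ x * y → 0# ≤ y
    *-cancelˡ-nonneg 0<x 0≤xy y<0 = 0≤xy (pos*neg 0<x y<0)

    *-cancelˡ-pos : ∀ {x y} → 0# < x → 0# < x * y → 0# < y
    *-cancelˡ-pos 0<x 0<xy with #⇒<⊎> (xy#0⇒y#0 (#-sym (<⇒# 0<xy)))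
    ... | inj₂ 0<y = 0<y
    ... | inj₁ y<0 = contradiction (pos*neg 0<x y<0) (<⇒≤ 0<xy)

  opaque

    *-cancelˡ-≈ : ∀ {x y z} → x # 0# → x * y ≈ x * z → y ≈ z
    *-cancelˡ-≈ {x} {y} {z} x#0 xy≈xz with #⇒invertible x#0
    ... | (v , v*x≈1 , _) = trans (sym (v*xw≈w y)) (trans (*-congˡ xy≈xz) (v*xw≈w z))
      where
      v*xw≈w : ∀ w → v * (x * w) ≈ w
      v*xw≈w w = trans (sym (*-assoc v x w)) (trans
        (*-congʳ (trans (*-congˡ (sym (x-0≈x x))) v*x≈1)) (*-identityˡ w))

    /-* : ∀ x {y} (y#0 : y # 0#) → y * (x / y ⟨ y#0 ⟩) ≈ x
    /-* x {y} y#0 with #⇒invertible y#0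
    ... | (v , _ , y*v≈1) = trans (solve 3 (λ x y v → y :* (x :* v) := (y :* v) :* x) refl x y v)
      (trans (*-congʳ (trans (*-congʳ (sym (x-0≈x y))) y*v≈1)) (*-identityˡ x))

    /-cross : ∀ {x y u v} (y#0 : y # 0#) (v#0 : v # 0#) →
              x * v ≈ u * y → x / y ⟨ y#0 ⟩ ≈ u / v ⟨ v#0 ⟩
    /-cross {x} {y} {u} {v} y#0 v#0 eq = *-cancelˡ-≈ (x#0y#0→xy#0 y#0 v#0) (trans
      (solve 3 (λ y v w → (y :* v) :* w := (y :* w) :* v) refl y v (x / y ⟨ y#0 ⟩)) (trans
      (*-congʳ (/-* x y#0)) (trans eq (trans (*-congʳ (sym (/-* u v#0)))
      (solve 3 (λ y v w → (v :* w) :* y := (y :* v) :* w) refl y v (u / v ⟨ v#0 ⟩))))))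

    /-cross⁻¹ : ∀ {x y u v} (y#0 : y # 0#) (v#0 : v # 0#) →
                x / y ⟨ y#0 ⟩ ≈ u / v ⟨ v#0 ⟩ → x * v ≈ u * y
    /-cross⁻¹ {x} {y} {u} {v} y#0 v#0 eq = trans (*-congʳ (sym (/-* x y#0))) (trans
      (*-congʳ (*-congˡ eq)) (trans
      (solve 3 (λ y v w → (y :* w) :* v := (v :* w) :* y) refl y v (u / v ⟨ v#0 ⟩))
      (*-congʳ (/-* u v#0))))

  opaque

    ι0<ι : ∀ {q} → 0ℚ Rat.< q → 0# < ι q
    ι0<ι 0<q = <-respˡ-≈ 0#-homo (ι-mono-< 0<q)

    ι-cancel-< : ∀ {p q} → ι p < ι q → p Rat.< q
    ι-cancel-< {p} {q} ιp<ιq with RatP.<-cmp p q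
    ... | tri< p<q _ _      = p<q
    ... | tri≈ _ ≡.refl _   = ⊥-elim (<-irrefl refl ιp<ιq)
    ... | tri> _ _ q<p      = ⊥-elim (<⇒≤ ιp<ιq (ι-mono-< q<p))

    ι-mono-≤ : ∀ {p q} → p Rat.≤ q → ι p ≤ ι q
    ι-mono-≤ p≤q ιq<ιp = RatP.<-irrefl ≡.refl (RatP.<-≤-trans (ι-cancel-< ιq<ιp) p≤q)

    ι-cancel-≤ : ∀ {p q} → ι p ≤ ι q → p Rat.≤ q
    ι-cancel-≤ ιp≤ιq = RatP.≮⇒≥ (λ q<p → ιp≤ιq (ι-mono-< q<p))

    0<ι1 : 0# < ι 1ℚ
    0<ι1 = ι0<ι (RatP.positive⁻¹ 1ℚ)

    0≤1+x : ∀ {x} → x ∈[-1,1] → 0# ≤ ι 1ℚ + x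
    0≤1+x {x} (-1≤x , _) = ≤-resp₂ refl (trans
      (solve 2 (λ x u → x :- (:- u) := u :+ x) refl x 1#) (+-congʳ (sym 1#-homo))) (x≤y⇒0≤y-x -1≤x)

    0≤1-x : ∀ {x} → x ∈[-1,1] → 0# ≤ ι 1ℚ - x
    0≤1-x (_ , x≤1) = ≤-resp₂ refl (+-congʳ (sym 1#-homo)) (x≤y⇒0≤y-x x≤1)

    ∈-intro : ∀ {x} → 0# ≤ ι 1ℚ + x → 0# ≤ ι 1ℚ - x → x ∈[-1,1]
    ∈-intro {x} 0≤1+x 0≤1-x =
      0≤y-x⇒x≤y (≤-resp₂ refl (trans (+-congʳ 1#-homo) (solve 2 (λ x u → u :+ x := x :- (:- u)) refl x 1#)) 0≤1+x) ,
      0≤y-x⇒x≤y (≤-resp₂ refl (+-congʳ 1#-homo) 0≤1-x)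

    ι∈ : ∀ {q} → Rat.- 1ℚ Rat.≤ q → q Rat.≤ 1ℚ → ι q ∈[-1,1]
    ι∈ -1≤q q≤1 = ≤-resp₂ (trans (-‿homo 1ℚ) (-‿cong 1#-homo)) refl (ι-mono-≤ -1≤q) ,
                  ≤-resp₂ refl 1#-homo (ι-mono-≤ q≤1)

  -- Towards the decidability of Incl: the sign of a rational bilinear form on
  -- the square is determined by its signs at the four corners.

  evalℚ : Row → ℚ → ℚ → ℚ
  evalℚ (row a b c d) x y = a Rat.* x Rat.* y Rat.+ b Rat.* x Rat.+ c Rat.* y Rat.+ d

  -1ℚ : ℚ
  -1ℚ = Rat.- 1ℚ

  Corners : ∀ {ℓ} → (ℚ → Set ℓ) → Row → Set ℓ
  Corners P u = P (evalℚ u -1ℚ -1ℚ) × P (evalℚ u 1ℚ -1ℚ) × P (evalℚ u -1ℚ 1ℚ) × P (evalℚ u 1ℚ 1ℚ)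

  corners? : ∀ {ℓ} {P : ℚ → Set ℓ} → (∀ q → Dec (P q)) → ∀ u → Dec (Corners P u)
  corners? P? u = P? _ ×-dec P? _ ×-dec P? _ ×-dec P? _

  -1∈ : ι -1ℚ ∈[-1,1]
  -1∈ = ι∈ RatP.≤-refl (from-yes (-1ℚ RatP.≤? 1ℚ))

  1∈ : ι 1ℚ ∈[-1,1]
  1∈ = ι∈ (from-yes (-1ℚ RatP.≤? 1ℚ)) RatP.≤-refl

  neg : Row → Row
  neg (row a b c d) = row (Rat.- a) (Rat.- b) (Rat.- c) (Rat.- d)

  negᵀ : Tensor → Tensor
  negᵀ (tensor n d) = tensor (neg n) (neg d)

  opaque

    ι-eval : ∀ u x y → ι (evalℚ u x y) ≈ ⟪ u ⟫ (ι x) (ι y)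
    ι-eval (row a b c d) x y = trans (+-homo _ d) (+-congʳ (trans (+-homo _ _) (+-cong
      (trans (+-homo _ _) (+-cong (trans (*-homo _ y) (*-congʳ (*-homo a x))) (*-homo b x)))
      (*-homo c y))))

    ι-sub : ∀ p q → ι (p Rat.- q) ≈ ι p - ι q
    ι-sub p q = trans (+-homo p (Rat.- q)) (+-congˡ (-‿homo q))

    ι-lin : ∀ k a l b → ι (k Rat.* a Rat.+ l Rat.* b) ≈ ι k * ι a + ι l * ι b
    ι-lin k a l b = trans (+-homo _ _) (+-cong (*-homo k a) (*-homo l b))

    lin-solve : ∀ k a b c d l a′ b′ c′ d′ x y →
      (k * a + l * a′) * x * y + (k * b + l * b′) * x + (k * c + l * c′) * y + (k * d + l * d′)
      ≈ k * (a * x * y + b * x + c * y + d) + l * (a′ * x * y + b′ * x + c′ * y + d′)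
    lin-solve = solve 12 (λ k a b c d l a′ b′ c′ d′ x y →
      (k :* a :+ l :* a′) :* x :* y :+ (k :* b :+ l :* b′) :* x :+ (k :* c :+ l :* c′) :* y :+ (k :* d :+ l :* d′)
      := k :* (a :* x :* y :+ b :* x :+ c :* y :+ d) :+ l :* (a′ :* x :* y :+ b′ :* x :+ c′ :* y :+ d′)) refl

    ⟪lin⟫ : ∀ k u l v x y → ⟪ lin k u l v ⟫ x y ≈ ι k * ⟪ u ⟫ x y + ι l * ⟪ v ⟫ x y
    ⟪lin⟫ k (row a b c d) l (row a′ b′ c′ d′) x y = trans
      (+-cong (+-cong (+-cong (*-congʳ (*-congʳ (ι-lin k a l a′))) (*-congʳ (ι-lin k b l b′)))
        (*-congʳ (ι-lin k c l c′))) (ι-lin k d l d′))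
      (lin-solve (ι k) (ι a) (ι b) (ι c) (ι d) (ι l) (ι a′) (ι b′) (ι c′) (ι d′) x y)

    neg-solve : ∀ a b c d x y →
      (- a) * x * y + (- b) * x + (- c) * y + (- d) ≈ - (a * x * y + b * x + c * y + d)
    neg-solve = solve 6 (λ a b c d x y →
      (:- a) :* x :* y :+ (:- b) :* x :+ (:- c) :* y :+ (:- d)
      := :- (a :* x :* y :+ b :* x :+ c :* y :+ d)) refl

    ⟪neg⟫ : ∀ u x y → ⟪ neg u ⟫ x y ≈ - ⟪ u ⟫ x y
    ⟪neg⟫ (row a b c d) x y = trans
      (+-cong (+-cong (+-cong (*-congʳ (*-congʳ (-‿homo a))) (*-congʳ (-‿homo b)))
        (*-congʳ (-‿homo c))) (-‿homo d))
      (neg-solve (ι a) (ι b) (ι c) (ι d) x y)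

  AffineClosed : (Carrier → Set ℓ₂) → Set (c ⊔ ℓ₂)
  AffineClosed P = ∀ {A B x} → x ∈[-1,1] → P (B - A) → P (B + A) → P (A * x + B)

  opaque

    affine-solve : ∀ A B x →
      (ι 1ℚ + x) * (B + A) + (ι 1ℚ - x) * (B - A) ≈ (ι 1ℚ + ι 1ℚ) * (A * x + B)
    affine-solve = solve 3 (λ A B x →
      (con 1ℚ :+ x) :* (B :+ A) :+ (con 1ℚ :- x) :* (B :- A)
      := (con 1ℚ :+ con 1ℚ) :* (A :* x :+ B)) refl

    0<2 : 0# < ι 1ℚ + ι 1ℚ
    0<2 = +-pos-nonneg 0<ι1 (<⇒≤ 0<ι1)

    affine-nonneg : AffineClosed (0# ≤_)
    affine-nonneg {A} {B} {x} x∈ l r = *-cancelˡ-nonneg 0<2 (≤-resp₂ refl (affine-solve A B x)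
      (+-nonneg (*-nonneg (0≤1+x x∈) r) (*-nonneg (0≤1-x x∈) l)))

    affine-pos : AffineClosed (0# <_)
    affine-pos {A} {B} {x} x∈ l r with <-cotrans 0<ι1 x
    ... | inj₁ 0<x = *-cancelˡ-pos 0<2 (<-resp₂ refl (affine-solve A B x)
      (+-pos-nonneg (*-pos (+-pos-nonneg 0<ι1 (<⇒≤ 0<x)) r) (*-nonneg (0≤1-x x∈) (<⇒≤ l))))
    ... | inj₂ x<1 = *-cancelˡ-pos 0<2 (<-resp₂ refl (trans (+-comm _ _) (affine-solve A B x))
      (+-pos-nonneg (*-pos (x<y⇒0<y-x x<1) l) (*-nonneg (0≤1+x x∈) (<⇒≤ r))))

    bilinear-solve : ∀ a b c d x y → (a * y + b) * x + (c * y + d) ≈ a * x * y + b * x + c * y + d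
    bilinear-solve = solve 6 (λ a b c d x y →
      (a :* y :+ b) :* x :+ (c :* y :+ d) := a :* x :* y :+ b :* x :+ c :* y :+ d) refl

    edge⁻-solve : ∀ a b c d y → (c - a) * y + (d - b) ≈ (c * y + d) - (a * y + b)
    edge⁻-solve = solve 5 (λ a b c d y →
      (c :- a) :* y :+ (d :- b) := (c :* y :+ d) :- (a :* y :+ b)) refl

    edge⁺-solve : ∀ a b c d y → (c + a) * y + (d + b) ≈ (c * y + d) + (a * y + b)
    edge⁺-solve = solve 5 (λ a b c d y →
      (c :+ a) :* y :+ (d :+ b) := (c :* y :+ d) :+ (a :* y :+ b)) refl

    corner-solve⁻⁻ : ∀ a b c d → a * ι -1ℚ * ι -1ℚ + b * ι -1ℚ + c * ι -1ℚ + d ≈ (d - b) - (c - a)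
    corner-solve⁻⁻ = solve 4 (λ a b c d →
      a :* con -1ℚ :* con -1ℚ :+ b :* con -1ℚ :+ c :* con -1ℚ :+ d := (d :- b) :- (c :- a)) refl

    corner-solve⁺⁻ : ∀ a b c d → a * ι 1ℚ * ι -1ℚ + b * ι 1ℚ + c * ι -1ℚ + d ≈ (d + b) - (c + a)
    corner-solve⁺⁻ = solve 4 (λ a b c d →
      a :* con 1ℚ :* con -1ℚ :+ b :* con 1ℚ :+ c :* con -1ℚ :+ d := (d :+ b) :- (c :+ a)) refl

    corner-solve⁻⁺ : ∀ a b c d → a * ι -1ℚ * ι 1ℚ + b * ι -1ℚ + c * ι 1ℚ + d ≈ (d - b) + (c - a)
    corner-solve⁻⁺ = solve 4 (λ a b c d →
      a :* con -1ℚ :* con 1ℚ :+ b :* con -1ℚ :+ c :* con 1ℚ :+ d := (d :- b) :+ (c :- a)) refl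

    corner-solve⁺⁺ : ∀ a b c d → a * ι 1ℚ * ι 1ℚ + b * ι 1ℚ + c * ι 1ℚ + d ≈ (d + b) + (c + a)
    corner-solve⁺⁺ = solve 4 (λ a b c d →
      a :* con 1ℚ :* con 1ℚ :+ b :* con 1ℚ :+ c :* con 1ℚ :+ d := (d :+ b) :+ (c :+ a)) refl

  opaque

    from-corners : (P : Carrier → Set ℓ₂) → (∀ {x y} → x ≈ y → P x → P y) → AffineClosed P →
      (u : Row) → Corners (λ q → P (ι q)) u → ∀ {x y} → x ∈[-1,1] → y ∈[-1,1] → P (⟪ u ⟫ x y)
    from-corners P resp affine u@(row a b c d) (p⁻⁻ , p⁺⁻ , p⁻⁺ , p⁺⁺) {x} {y} x∈ y∈ =
      resp (bilinear-solve _ _ _ _ x y) (affine x∈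
        (resp (edge⁻-solve _ _ _ _ y) (affine y∈
          (resp (trans (ι-eval u _ _) (corner-solve⁻⁻ _ _ _ _)) p⁻⁻)
          (resp (trans (ι-eval u _ _) (corner-solve⁻⁺ _ _ _ _)) p⁻⁺)))
        (resp (edge⁺-solve _ _ _ _ y) (affine y∈
          (resp (trans (ι-eval u _ _) (corner-solve⁺⁻ _ _ _ _)) p⁺⁻)
          (resp (trans (ι-eval u _ _) (corner-solve⁺⁺ _ _ _ _)) p⁺⁺))))

    corners-nonneg : ∀ u → Corners (0ℚ Rat.≤_) u →
      ∀ {x y} → x ∈[-1,1] → y ∈[-1,1] → 0# ≤ ⟪ u ⟫ x y
    corners-nonneg u (p , q , r , s) = from-corners (0# ≤_) (≤-resp₂ refl) affine-nonneg u
      (f p , f q , f r , f s)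
      where
      f : ∀ {q} → 0ℚ Rat.≤ q → 0# ≤ ι q
      f 0≤q = ≤-resp₂ 0#-homo refl (ι-mono-≤ 0≤q)

    corners-pos : ∀ u → Corners (0ℚ Rat.<_) u →
      ∀ {x y} → x ∈[-1,1] → y ∈[-1,1] → 0# < ⟪ u ⟫ x y
    corners-pos u (p , q , r , s) = from-corners (0# <_) (<-resp₂ refl) affine-pos u
      (ι0<ι p , ι0<ι q , ι0<ι r , ι0<ι s)

  opaque

    -- The root of A u + B is - B / A.
    root : ∀ A B → 0ℚ Rat.< B Rat.- A →
      (∀ u → -1ℚ Rat.≤ u → u Rat.≤ 1ℚ → A Rat.* u Rat.+ B ≢ 0ℚ) → 0ℚ Rat.< B Rat.+ A
    root A B 0<B-A no-root with RatP.<-cmp 0ℚ (B Rat.+ A)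
    ... | tri< 0<B+A _ _ = 0<B+A
    ... | tri≈ _ 0≡B+A _ = contradiction
      (≡.trans (solveℚ 2 (λ A B → A :*ℚ conℚ 1ℚ :+ℚ B :=ℚ B :+ℚ A) ≡.refl A B) (≡.sym 0≡B+A))
      (no-root 1ℚ (from-yes (-1ℚ RatP.≤? 1ℚ)) RatP.≤-refl)
    ... | tri> _ _ B+A<0 = contradiction Au+B≡0 (no-root u -1≤u u≤1)
      where
      N : ℚ
      N = Rat.- A

      B<N : B Rat.< N
      B<N = ≡.subst₂ Rat._<_ (solveℚ 2 (λ A B → (B :+ℚ A) :-ℚ A :=ℚ B) ≡.refl A B)
        (RatP.+-identityˡ N) (RatP.+-monoˡ-< N B+A<0)

      -N<B : Rat.- N Rat.< B
      -N<B = ≡.subst₂ Rat._<_ (solveℚ 1 (λ A → conℚ 0ℚ :+ℚ A :=ℚ :-ℚ (:-ℚ A)) ≡.refl A)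
        (solveℚ 2 (λ A B → (B :-ℚ A) :+ℚ A :=ℚ B) ≡.refl A B) (RatP.+-monoˡ-< A 0<B-A)

      -N<N : Rat.- N Rat.< N
      -N<N = RatP.<-trans -N<B B<N

      0<N : 0ℚ Rat.< N
      0<N with RatP.<-cmp 0ℚ N
      ... | tri< 0<N _ _    = 0<N
      ... | tri≈ _ 0≡N _    = contradiction -N<N
        (≡.subst (λ M → ¬ (Rat.- M Rat.< M)) 0≡N (RatP.<-irrefl ≡.refl))
      ... | tri> _ _ N<0    = contradiction
        (RatP.<-trans N<0 (RatP.neg-antimono-< N<0)) (λ N<-N → RatP.<-irrefl ≡.refl (RatP.<-trans N<-N -N<N))

      instance
        N-pos : Rat.Positive N
        N-pos = Rat.positive 0<N

        N≢0 : Rat.NonZero N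
        N≢0 = RatP.pos⇒nonZero N

      u : ℚ
      u = B Rat.* Rat.1/ N

      uN≡B : u Rat.* N ≡ B
      uN≡B = ≡.trans (RatP.*-assoc B (Rat.1/ N) N)
        (≡.trans (≡.cong (B Rat.*_) (RatP.*-inverseˡ N)) (RatP.*-identityʳ B))

      u≤1 : u Rat.≤ 1ℚ
      u≤1 = RatP.*-cancelʳ-≤-pos N
        (≡.subst₂ Rat._≤_ (≡.sym uN≡B) (≡.sym (RatP.*-identityˡ N)) (RatP.<⇒≤ B<N))

      -1≤u : -1ℚ Rat.≤ u
      -1≤u = RatP.*-cancelʳ-≤-pos N (≡.subst₂ Rat._≤_
        (solveℚ 1 (λ N → :-ℚ N :=ℚ conℚ -1ℚ :*ℚ N) ≡.refl N) (≡.sym uN≡B) (RatP.<⇒≤ -N<B))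

      Au+B≡0 : A Rat.* u Rat.+ B ≡ 0ℚ
      Au+B≡0 = ≡.trans (≡.cong (A Rat.* u Rat.+_) (≡.sym uN≡B))
        (solveℚ 2 (λ A u → A :*ℚ u :+ℚ u :*ℚ (:-ℚ A) :=ℚ conℚ 0ℚ) ≡.refl A u)

  opaque

    root′ : ∀ A B → 0# < ι B - ι A →
      (∀ u → ι u ∈[-1,1] → ι A * ι u + ι B # 0#) → 0# < ι B + ι A
    root′ A B 0<B-A no-root = <-respʳ-≈ (+-homo B A) (ι0<ι (root A B
      (ι-cancel-< (<-resp₂ (sym 0#-homo) (sym (ι-sub B A)) 0<B-A))
      λ u -1≤u u≤1 eq → #-irrefl
        (trans (sym (trans (+-homo _ B) (+-congʳ (*-homo A u)))) (trans (ι-cong eq) 0#-homo))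
        (no-root u (ι∈ -1≤u u≤1))))

  opaque

    edge : ∀ u A B x₀ y₀ x₁ y₁ →
      ⟪ u ⟫ (ι x₀) (ι y₀) ≈ ι B - ι A → ⟪ u ⟫ (ι x₁) (ι y₁) ≈ ι B + ι A →
      (∀ t → ι t ∈[-1,1] → ι A * ι t + ι B # 0#) →
      0ℚ Rat.< evalℚ u x₀ y₀ → 0ℚ Rat.< evalℚ u x₁ y₁
    edge u A B x₀ y₀ x₁ y₁ eq₀ eq₁ no-root 0<u₀ = ι-cancel-< (<-resp₂ (sym 0#-homo)
      (sym (trans (ι-eval u x₁ y₁) eq₁))
      (root′ A B (<-respʳ-≈ (trans (ι-eval u x₀ y₀) eq₀) (ι0<ι 0<u₀)) no-root))

    bottom⁻-solve : ∀ a b c d → (d - b) - (c - a) ≈ (d - c) - (b - a)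
    bottom⁻-solve = solve 4 (λ a b c d → (d :- b) :- (c :- a) := (d :- c) :- (b :- a)) refl

    bottom⁺-solve : ∀ a b c d → (d + b) - (c + a) ≈ (d - c) + (b - a)
    bottom⁺-solve = solve 4 (λ a b c d → (d :+ b) :- (c :+ a) := (d :- c) :+ (b :- a)) refl

    bottom-solve : ∀ a b c d x → a * x * ι -1ℚ + b * x + c * ι -1ℚ + d ≈ (b - a) * x + (d - c)
    bottom-solve = solve 5 (λ a b c d x →
      a :* x :* con -1ℚ :+ b :* x :+ c :* con -1ℚ :+ d := (b :- a) :* x :+ (d :- c)) refl

    left-solve : ∀ a b c d y → a * ι -1ℚ * y + b * ι -1ℚ + c * y + d ≈ (c - a) * y + (d - b)
    left-solve = solve 5 (λ a b c d y →
      a :* con -1ℚ :* y :+ b :* con -1ℚ :+ c :* y :+ d := (c :- a) :* y :+ (d :- b)) refl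

    right-solve : ∀ a b c d y → a * ι 1ℚ * y + b * ι 1ℚ + c * y + d ≈ (c + a) * y + (d + b)
    right-solve = solve 5 (λ a b c d y →
      a :* con 1ℚ :* y :+ b :* con 1ℚ :+ c :* y :+ d := (c :+ a) :* y :+ (d :+ b)) refl

  opaque

    corners-same-sign : ∀ u → (∀ {x y} → x ∈[-1,1] → y ∈[-1,1] → ⟪ u ⟫ x y # 0#) →
      0ℚ Rat.< evalℚ u -1ℚ -1ℚ → Corners (0ℚ Rat.<_) u
    corners-same-sign u@(row a b c d) no-zero p⁻⁻ = p⁻⁻ , p⁺⁻ , p⁻⁺ , p⁺⁺
      where
      p⁺⁻ : 0ℚ Rat.< evalℚ u 1ℚ -1ℚ
      p⁺⁻ = edge u (b Rat.- a) (d Rat.- c) -1ℚ -1ℚ 1ℚ -1ℚ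
        (trans (corner-solve⁻⁻ _ _ _ _) (trans (bottom⁻-solve _ _ _ _)
          (sym (+-cong (ι-sub d c) (-‿cong (ι-sub b a))))))
        (trans (corner-solve⁺⁻ _ _ _ _) (trans (bottom⁺-solve _ _ _ _)
          (sym (+-cong (ι-sub d c) (ι-sub b a)))))
        (λ t t∈ → #-congʳ (trans (bottom-solve _ _ _ _ _)
          (sym (+-cong (*-congʳ (ι-sub b a)) (ι-sub d c)))) (no-zero t∈ -1∈))
        p⁻⁻

      p⁻⁺ : 0ℚ Rat.< evalℚ u -1ℚ 1ℚ
      p⁻⁺ = edge u (c Rat.- a) (d Rat.- b) -1ℚ -1ℚ -1ℚ 1ℚ
        (trans (corner-solve⁻⁻ _ _ _ _) (sym (+-cong (ι-sub d b) (-‿cong (ι-sub c a)))))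
        (trans (corner-solve⁻⁺ _ _ _ _) (sym (+-cong (ι-sub d b) (ι-sub c a))))
        (λ t t∈ → #-congʳ (trans (left-solve _ _ _ _ _)
          (sym (+-cong (*-congʳ (ι-sub c a)) (ι-sub d b)))) (no-zero -1∈ t∈))
        p⁻⁻

      p⁺⁺ : 0ℚ Rat.< evalℚ u 1ℚ 1ℚ
      p⁺⁺ = edge u (c Rat.+ a) (d Rat.+ b) 1ℚ -1ℚ 1ℚ 1ℚ
        (trans (corner-solve⁺⁻ _ _ _ _) (sym (+-cong (+-homo d b) (-‿cong (+-homo c a)))))
        (trans (corner-solve⁺⁺ _ _ _ _) (sym (+-cong (+-homo d b) (+-homo c a))))
        (λ t t∈ → #-congʳ (trans (right-solve _ _ _ _ _)
          (sym (+-cong (*-congʳ (+-homo c a)) (+-homo d b)))) (no-zero 1∈ t∈))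
        p⁺⁻

  module Criterion (μ : Möbius) (n d : Row) where

    open Möbius μ

    -- The rows of the adjugate of μ applied to (n , d).
    S E : Row
    S = lin s n (Rat.- q) d
    E = lin (Rat.- r) n p d

    record Holds : Set where
      constructor holds
      field
        d-pos   : Corners (0ℚ Rat.<_) d
        E-pos   : Corners (0ℚ Rat.<_) E
        E-S-pos : Corners (0ℚ Rat.≤_) (lin 1ℚ E -1ℚ S)
        E+S-pos : Corners (0ℚ Rat.≤_) (lin 1ℚ E 1ℚ S)

    holds? : Dec Holds
    holds? = map′ (λ (w , x , y , z) → holds w x y z) (λ (holds w x y z) → w , x , y , z)
      (corners? (0ℚ RatP.<?_) d ×-dec corners? (0ℚ RatP.<?_) E ×-dec
       corners? (0ℚ RatP.≤?_) (lin 1ℚ E -1ℚ S) ×-dec corners? (0ℚ RatP.≤?_) (lin 1ℚ E 1ℚ S))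

    opaque

      ⟪S⟫ : ∀ x y → ⟪ S ⟫ x y ≈ ι s * ⟪ n ⟫ x y - ι q * ⟪ d ⟫ x y
      ⟪S⟫ x y = trans (⟪lin⟫ s n (Rat.- q) d x y) (+-congˡ (trans (*-congʳ (-‿homo q))
        (solve 2 (λ q D → (:- q) :* D := :- (q :* D)) refl (ι q) (⟪ d ⟫ x y))))

      ⟪E⟫ : ∀ x y → ⟪ E ⟫ x y ≈ ι p * ⟪ d ⟫ x y - ι r * ⟪ n ⟫ x y
      ⟪E⟫ x y = trans (⟪lin⟫ (Rat.- r) n p d x y) (trans (+-congʳ (*-congʳ (-‿homo r)))
        (solve 4 (λ r N p D → (:- r) :* N :+ p :* D := p :* D :- r :* N) refl
          (ι r) (⟪ n ⟫ x y) (ι p) (⟪ d ⟫ x y)))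

      ⟪E-S⟫ : ∀ x y → ⟪ lin 1ℚ E -1ℚ S ⟫ x y ≈ ⟪ E ⟫ x y - ⟪ S ⟫ x y
      ⟪E-S⟫ x y = trans (⟪lin⟫ 1ℚ E -1ℚ S x y)
        (solve 2 (λ E S → con 1ℚ :* E :+ con -1ℚ :* S := E :- S) refl (⟪ E ⟫ x y) (⟪ S ⟫ x y))

      ⟪E+S⟫ : ∀ x y → ⟪ lin 1ℚ E 1ℚ S ⟫ x y ≈ ⟪ E ⟫ x y + ⟪ S ⟫ x y
      ⟪E+S⟫ x y = trans (⟪lin⟫ 1ℚ E 1ℚ S x y)
        (solve 2 (λ E S → con 1ℚ :* E :+ con 1ℚ :* S := E :+ S) refl (⟪ E ⟫ x y) (⟪ S ⟫ x y))

    detᴿ : Carrier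
    detᴿ = ι p * ι s - ι q * ι r

    opaque

      den-identity : ∀ {z N D S E} → S ≈ ι s * N - ι q * D → E ≈ ι p * D - ι r * N → E * z ≈ S →
        E * (ι r * z + ι s) ≈ detᴿ * D
      den-identity {z} {N} {D} {S} {E} S≈ E≈ Ez≈S = trans
        (solve 4 (λ r s E z → E :* (r :* z :+ s) := r :* (E :* z) :+ s :* E) refl (ι r) (ι s) E z)
        (trans (+-cong (*-congˡ (trans Ez≈S S≈)) (*-congˡ E≈))
          (solve 6 (λ p q r s N D → r :* (s :* N :- q :* D) :+ s :* (p :* D :- r :* N)
            := (p :* s :- q :* r) :* D) refl (ι p) (ι q) (ι r) (ι s) N D))

      num-identity : ∀ {z N D S E} → S ≈ ι s * N - ι q * D → E ≈ ι p * D - ι r * N → E * z ≈ S →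
        E * (ι p * z + ι q) ≈ detᴿ * N
      num-identity {z} {N} {D} {S} {E} S≈ E≈ Ez≈S = trans
        (solve 4 (λ p q E z → E :* (p :* z :+ q) := p :* (E :* z) :+ q :* E) refl (ι p) (ι q) E z)
        (trans (+-cong (*-congˡ (trans Ez≈S S≈)) (*-congˡ E≈))
          (solve 6 (λ p q r s N D → p :* (s :* N :- q :* D) :+ q :* (p :* D :- r :* N)
            := (p :* s :- q :* r) :* N) refl (ι p) (ι q) (ι r) (ι s) N D))

      E-identity : ∀ {z N D E} → E ≈ ι p * D - ι r * N →
        N * (ι r * z + ι s) ≈ (ι p * z + ι q) * D → (ι r * z + ι s) * E ≈ detᴿ * D
      E-identity {z} {N} {D} {E} E≈ cross = trans (*-congˡ E≈) (trans
        (solve 5 (λ w p D r N → w :* (p :* D :- r :* N) := w :* p :* D :- r :* (N :* w)) refl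
          (ι r * z + ι s) (ι p) D (ι r) N)
        (trans (+-congˡ (-‿cong (*-congˡ cross)))
          (solve 6 (λ p q r s z D → (r :* z :+ s) :* p :* D :- r :* ((p :* z :+ q) :* D)
            := (p :* s :- q :* r) :* D) refl (ι p) (ι q) (ι r) (ι s) z D)))

      S-identity : ∀ {z N D S} → S ≈ ι s * N - ι q * D →
        N * (ι r * z + ι s) ≈ (ι p * z + ι q) * D → (ι r * z + ι s) * S ≈ detᴿ * D * z
      S-identity {z} {N} {D} {S} S≈ cross = trans (*-congˡ S≈) (trans
        (solve 5 (λ w q D s N → w :* (s :* N :- q :* D) := s :* (N :* w) :- w :* q :* D) refl
          (ι r * z + ι s) (ι q) D (ι s) N)
        (trans (+-congʳ (*-congˡ cross))
          (solve 6 (λ p q r s z D → s :* ((p :* z :+ q) :* D) :- (r :* z :+ s) :* q :* D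
            := (p :* s :- q :* r) :* D :* z) refl (ι p) (ι q) (ι r) (ι s) z D)))

      factor⁻ : ∀ w k z {E S} → w * E ≈ k → w * S ≈ k * z → k * (ι 1ℚ - z) ≈ w * (E - S)
      factor⁻ w k z {E} {S} wE wS = trans
        (solve 2 (λ k z → k :* (con 1ℚ :- z) := k :- k :* z) refl k z)
        (trans (+-cong (sym wE) (-‿cong (sym wS)))
          (solve 3 (λ w E S → w :* E :- w :* S := w :* (E :- S)) refl w E S))

      factor⁺ : ∀ w k z {E S} → w * E ≈ k → w * S ≈ k * z → k * (ι 1ℚ + z) ≈ w * (E + S)
      factor⁺ w k z {E} {S} wE wS = trans
        (solve 2 (λ k z → k :* (con 1ℚ :+ z) := k :+ k :* z) refl k z)
        (trans (+-cong (sym wE) (sym wS)) (sym (distribˡ w E S)))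

      factor₁⁻ : ∀ E z {S} → E * z ≈ S → E - S ≈ E * (ι 1ℚ - z)
      factor₁⁻ E z Ez≈S = trans (+-congˡ (-‿cong (sym Ez≈S)))
        (solve 2 (λ E z → E :- E :* z := E :* (con 1ℚ :- z)) refl E z)

      factor₁⁺ : ∀ E z {S} → E * z ≈ S → E + S ≈ E * (ι 1ℚ + z)
      factor₁⁺ E z Ez≈S = trans (+-congˡ (sym Ez≈S))
        (solve 2 (λ E z → E :+ E :* z := E :* (con 1ℚ :+ z)) refl E z)

    module _ (0<det : 0# < detᴿ) (0<s-r : 0# < ι s - ι r) (0<s+r : 0# < ι s + ι r) where

      opaque

        sound-bounded : Holds → ∀ {x y} → x ∈[-1,1] → y ∈[-1,1] → ⟪ d ⟫ x y # 0#
        sound-bounded (holds d-pos _ _ _) x∈ y∈ = #-sym (<⇒# (corners-pos d d-pos x∈ y∈))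

        sound-image : Holds → ∀ {x y} → x ∈[-1,1] → y ∈[-1,1] → (nz : ⟪ d ⟫ x y # 0#) →
          (⟪ n ⟫ x y / ⟪ d ⟫ x y ⟨ nz ⟩) ∈Image μ
        sound-image (holds d-pos E-pos E-S-pos E+S-pos) {x} {y} x∈ y∈ nz =
          z , ∈-intro 0≤1+z 0≤1-z , w#0 , /-cross nz w#0 cross
          where
          0<E : 0# < ⟪ E ⟫ x y
          0<E = corners-pos E E-pos x∈ y∈

          E#0 : ⟪ E ⟫ x y # 0#
          E#0 = #-sym (<⇒# 0<E)

          z : Carrier
          z = ⟪ S ⟫ x y / ⟪ E ⟫ x y ⟨ E#0 ⟩

          Ez≈S : ⟪ E ⟫ x y * z ≈ ⟪ S ⟫ x y
          Ez≈S = /-* (⟪ S ⟫ x y) E#0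

          0≤1-z : 0# ≤ ι 1ℚ - z
          0≤1-z = *-cancelˡ-nonneg 0<E (≤-resp₂ refl (trans (⟪E-S⟫ x y) (factor₁⁻ _ z Ez≈S))
            (corners-nonneg (lin 1ℚ E -1ℚ S) E-S-pos x∈ y∈))

          0≤1+z : 0# ≤ ι 1ℚ + z
          0≤1+z = *-cancelˡ-nonneg 0<E (≤-resp₂ refl (trans (⟪E+S⟫ x y) (factor₁⁺ _ z Ez≈S))
            (corners-nonneg (lin 1ℚ E 1ℚ S) E+S-pos x∈ y∈))

          Ew≈ : ⟪ E ⟫ x y * (ι r * z + ι s) ≈ detᴿ * ⟪ d ⟫ x y
          Ew≈ = den-identity (⟪S⟫ x y) (⟪E⟫ x y) Ez≈S

          Ev≈ : ⟪ E ⟫ x y * (ι p * z + ι q) ≈ detᴿ * ⟪ n ⟫ x y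
          Ev≈ = num-identity (⟪S⟫ x y) (⟪E⟫ x y) Ez≈S

          w#0 : ι r * z + ι s # 0#
          w#0 = xy#0⇒y#0 (#-congʳ (sym Ew≈) (x#0y#0→xy#0 (#-sym (<⇒# 0<det)) nz))

          cross : ⟪ n ⟫ x y * (ι r * z + ι s) ≈ (ι p * z + ι q) * ⟪ d ⟫ x y
          cross = *-cancelˡ-≈ E#0 (trans
            (solve 3 (λ E N w → E :* (N :* w) := N :* (E :* w)) refl (⟪ E ⟫ x y) (⟪ n ⟫ x y) (ι r * z + ι s))
            (trans (*-congˡ Ew≈) (trans
            (solve 3 (λ N t D → N :* (t :* D) := (t :* N) :* D) refl (⟪ n ⟫ x y) detᴿ (⟪ d ⟫ x y))
            (trans (*-congʳ (sym Ev≈)) (*-assoc _ _ _)))))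

        complete-criterion :
          (bounded : ∀ {x y} → x ∈[-1,1] → y ∈[-1,1] → ⟪ d ⟫ x y # 0#) →
          (∀ {x y} (x∈ : x ∈[-1,1]) (y∈ : y ∈[-1,1]) → (⟪ n ⟫ x y / ⟪ d ⟫ x y ⟨ bounded x∈ y∈ ⟩) ∈Image μ) →
          0ℚ Rat.< evalℚ d -1ℚ -1ℚ → Holds
        complete-criterion bounded image 0<d⁻⁻ = holds d-pos
          (corner (0ℚ Rat.<_) E (λ {x} {y} x∈ y∈ → reflect< E {x} {y} (proj₁ (at x∈ y∈))))
          (corner (0ℚ Rat.≤_) (lin 1ℚ E -1ℚ S) (λ {x} {y} x∈ y∈ → reflect≤ (lin 1ℚ E -1ℚ S) {x} {y}
            (≤-resp₂ refl (sym (⟪E-S⟫ _ _)) (proj₁ (proj₂ (at x∈ y∈))))))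
          (corner (0ℚ Rat.≤_) (lin 1ℚ E 1ℚ S) (λ {x} {y} x∈ y∈ → reflect≤ (lin 1ℚ E 1ℚ S) {x} {y}
            (≤-resp₂ refl (sym (⟪E+S⟫ _ _)) (proj₂ (proj₂ (at x∈ y∈))))))
          where
          d-pos : Corners (0ℚ Rat.<_) d
          d-pos = corners-same-sign d bounded 0<d⁻⁻

          corner : (P : ℚ → Set) (u : Row) → (∀ {x y} → ι x ∈[-1,1] → ι y ∈[-1,1] → P (evalℚ u x y)) → Corners P u
          corner P u f = f -1∈ -1∈ , f 1∈ -1∈ , f -1∈ 1∈ , f 1∈ 1∈

          reflect< : ∀ u {x y} → 0# < ⟪ u ⟫ (ι x) (ι y) → 0ℚ Rat.< evalℚ u x y
          reflect< u {x} {y} 0<u = ι-cancel-< (<-resp₂ (sym 0#-homo) (sym (ι-eval u x y)) 0<u)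

          reflect≤ : ∀ u {x y} → 0# ≤ ⟪ u ⟫ (ι x) (ι y) → 0ℚ Rat.≤ evalℚ u x y
          reflect≤ u {x} {y} 0≤u = ι-cancel-≤ (≤-resp₂ (sym 0#-homo) (sym (ι-eval u x y)) 0≤u)

          at : ∀ {x y} → x ∈[-1,1] → y ∈[-1,1] →
            0# < ⟪ E ⟫ x y × 0# ≤ ⟪ E ⟫ x y - ⟪ S ⟫ x y × 0# ≤ ⟪ E ⟫ x y + ⟪ S ⟫ x y
          at {x} {y} x∈ y∈ = go (image x∈ y∈)
            where
            go : (⟪ n ⟫ x y / ⟪ d ⟫ x y ⟨ bounded x∈ y∈ ⟩) ∈Image μ →
              0# < ⟪ E ⟫ x y × 0# ≤ ⟪ E ⟫ x y - ⟪ S ⟫ x y × 0# ≤ ⟪ E ⟫ x y + ⟪ S ⟫ x y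
            go (z , z∈ , w#0 , eq) =
              *-cancelˡ-pos 0<w (<-resp₂ refl (sym wE) 0<k) ,
              *-cancelˡ-nonneg 0<w (≤-resp₂ refl (factor⁻ _ _ z wE wS)
                (*-nonneg (<⇒≤ 0<k) (0≤1-x z∈))) ,
              *-cancelˡ-nonneg 0<w (≤-resp₂ refl (factor⁺ _ _ z wE wS)
                (*-nonneg (<⇒≤ 0<k) (0≤1+x z∈)))
              where
              0<k : 0# < detᴿ * ⟪ d ⟫ x y
              0<k = *-pos 0<det (corners-pos d d-pos x∈ y∈)

              0<w : 0# < ι r * z + ι s
              0<w = affine-pos z∈ 0<s-r 0<s+r

              cross : ⟪ n ⟫ x y * (ι r * z + ι s) ≈ (ι p * z + ι q) * ⟪ d ⟫ x y
              cross = /-cross⁻¹ (bounded x∈ y∈) w#0 eq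

              wE : (ι r * z + ι s) * ⟪ E ⟫ x y ≈ detᴿ * ⟪ d ⟫ x y
              wE = E-identity (⟪E⟫ x y) cross

              wS : (ι r * z + ι s) * ⟪ S ⟫ x y ≈ detᴿ * ⟪ d ⟫ x y * z
              wS = S-identity (⟪S⟫ x y) cross

  opaque

    -#0 : ∀ {x} → x # 0# → - x # 0#
    -#0 {x} x#0 = xy#0⇒x#0 (#-congʳ (solve 1 (λ x → x :* x := (:- x) :* (:- x)) refl x)
      (x#0y#0→xy#0 x#0 x#0))

    /-neg : ∀ {x x′ y y′} → x′ ≈ - x → y′ ≈ - y → x′ * y ≈ x * y′
    /-neg {x} {x′} {y} {y′} x′≈ y′≈ = trans (*-congʳ x′≈) (trans
      (solve 2 (λ x y → (:- x) :* y := x :* (:- y)) refl x y) (*-congˡ (sym y′≈)))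

    Incl-neg : ∀ {ξ ξ′ φ} →
      (∀ x y → numerator ξ′ x y ≈ - numerator ξ x y) →
      (∀ x y → denominator ξ′ x y ≈ - denominator ξ x y) →
      Incl ξ φ → Incl ξ′ φ
    Incl-neg {ξ} {ξ′} {φ} num≈ den≈ (bounded , image) = bounded′ , image′
      where
      bounded′ : Bounded ξ′
      bounded′ x∈ y∈ = #-congʳ (sym (den≈ _ _)) (-#0 (bounded x∈ y∈))

      image′ : ∀ {x y} (x∈ : x ∈[-1,1]) (y∈ : y ∈[-1,1]) →
        apply ξ′ x y (bounded′ x∈ y∈) ∈Image ⟦ φ ⟧
      image′ x∈ y∈ = let (z , z∈ , nz , eq) = image x∈ y∈ in z , z∈ , nz ,
        trans (/-cross (bounded′ x∈ y∈) (bounded x∈ y∈) (/-neg (num≈ _ _) (den≈ _ _))) eq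

    ⟪neg⟫⁻¹ : ∀ u x y → ⟪ u ⟫ x y ≈ - ⟪ neg u ⟫ x y
    ⟪neg⟫⁻¹ u x y = trans (solve 1 (λ w → w := :- (:- w)) refl (⟪ u ⟫ x y)) (-‿cong (sym (⟪neg⟫ u x y)))

    eval-neg : ∀ u x y → evalℚ u x y Rat.< 0ℚ → 0ℚ Rat.< evalℚ (neg u) x y
    eval-neg u x y u<0 = ι-cancel-< (<-resp₂ (sym 0#-homo)
      (sym (trans (ι-eval (neg u) x y) (trans (⟪neg⟫ u (ι x) (ι y)) (-‿cong (sym (ι-eval u x y))))))
      (x<0⇒0<-x (<-respʳ-≈ 0#-homo (ι-mono-< u<0))))

    det-pos : ∀ φ → let open Möbius ⟦ φ ⟧ in 0# < ι p * ι s - ι q * ι r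
    det-pos φ = <-respʳ-≈ (trans (ι-sub (p Rat.* s) (q Rat.* r)) (+-cong (*-homo p s) (-‿cong (*-homo q r))))
      (ι0<ι (pos φ))
      where
      open Möbius ⟦ φ ⟧

      pos : ∀ φ → 0ℚ Rat.< det ⟦ φ ⟧
      pos 𝐋 = from-yes (0ℚ RatP.<? det ⟦ 𝐋 ⟧)
      pos 𝐑 = from-yes (0ℚ RatP.<? det ⟦ 𝐑 ⟧)
      pos 𝐌 = from-yes (0ℚ RatP.<? det ⟦ 𝐌 ⟧)

    s-r-pos : ∀ φ → let open Möbius ⟦ φ ⟧ in 0# < ι s - ι r
    s-r-pos φ = <-respʳ-≈ (ι-sub s r) (ι0<ι (pos φ))
      where
      open Möbius ⟦ φ ⟧

      pos : ∀ φ → 0ℚ Rat.< Möbius.s ⟦ φ ⟧ Rat.- Möbius.r ⟦ φ ⟧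
      pos 𝐋 = from-yes (0ℚ RatP.<? 1ℚ)
      pos 𝐑 = from-yes (0ℚ RatP.<? (+ 2 Rat./ 1))
      pos 𝐌 = from-yes (0ℚ RatP.<? (+ 3 Rat./ 1))

    s+r-pos : ∀ φ → let open Möbius ⟦ φ ⟧ in 0# < ι s + ι r
    s+r-pos φ = <-respʳ-≈ (+-homo s r) (ι0<ι (pos φ))
      where
      open Möbius ⟦ φ ⟧

      pos : ∀ φ → 0ℚ Rat.< Möbius.s ⟦ φ ⟧ Rat.+ Möbius.r ⟦ φ ⟧
      pos 𝐋 = from-yes (0ℚ RatP.<? (+ 2 Rat./ 1))
      pos 𝐑 = from-yes (0ℚ RatP.<? 1ℚ)
      pos 𝐌 = from-yes (0ℚ RatP.<? (+ 3 Rat./ 1))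

  opaque

    incl? : ∀ ξ φ → Dec (Incl ξ φ)
    incl? ξ@(tensor n d) φ = map′ to from (⁺.holds? ⊎-dec ⁻.holds?)
      where
      module ⁺ = Criterion ⟦ φ ⟧ n d
      module ⁻ = Criterion ⟦ φ ⟧ (neg n) (neg d)

      to : ⁺.Holds ⊎ ⁻.Holds → Incl ξ φ
      to (inj₁ h) = ⁺.sound-bounded (det-pos φ) (s-r-pos φ) (s+r-pos φ) h ,
        λ x∈ y∈ → ⁺.sound-image (det-pos φ) (s-r-pos φ) (s+r-pos φ) h x∈ y∈ _
      to (inj₂ h) = Incl-neg {negᵀ ξ} {ξ} {φ} (⟪neg⟫⁻¹ n) (⟪neg⟫⁻¹ d)
        (⁻.sound-bounded (det-pos φ) (s-r-pos φ) (s+r-pos φ) h ,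
         λ x∈ y∈ → ⁻.sound-image (det-pos φ) (s-r-pos φ) (s+r-pos φ) h x∈ y∈ _)

      from : Incl ξ φ → ⁺.Holds ⊎ ⁻.Holds
      from incl = split (RatP.<-cmp 0ℚ (evalℚ d -1ℚ -1ℚ))
        where
        incl⁻ : Incl (negᵀ ξ) φ
        incl⁻ = Incl-neg {ξ} {negᵀ ξ} {φ} (⟪neg⟫ n) (⟪neg⟫ d) incl

        split : Tri (0ℚ Rat.< evalℚ d -1ℚ -1ℚ) (0ℚ ≡ evalℚ d -1ℚ -1ℚ) (evalℚ d -1ℚ -1ℚ Rat.< 0ℚ) →
          ⁺.Holds ⊎ ⁻.Holds
        split (tri< 0<v _ _) = inj₁ (⁺.complete-criterion (det-pos φ) (s-r-pos φ) (s+r-pos φ)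
          (proj₁ incl) (proj₂ incl) 0<v)
        split (tri≈ _ 0≡v _) = ⊥-elim (#-irrefl
          (trans (sym (ι-eval d -1ℚ -1ℚ)) (trans (ι-cong (≡.sym 0≡v)) 0#-homo))
          (proj₁ incl -1∈ -1∈))
        split (tri> _ _ v<0) = inj₂ (⁻.complete-criterion (det-pos φ) (s-r-pos φ) (s+r-pos φ)
          (proj₁ incl⁻) (proj₂ incl⁻) (eval-neg d -1ℚ -1ℚ v<0))

  absorb : Tensor → Digit^ω → Digit^ω → Tensor
  absorb ξ α β = ξ •₁ ⟦ hd α ⟧ •₂ ⟦ hd β ⟧

  data E_q (ξ : Tensor) (α β : Digit^ω) : Set (c ⊔ ℓ₁ ⊔ ℓ₂) where
    emit : (φ : Digit) → Incl ξ φ → E_q ξ α β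
    next : E_q (absorb ξ α β) (tl α) (tl β) → E_q ξ α β

  Output : Set
  Output = Digit × Tensor × Digit^ω × Digit^ω

  m̄_q : ∀ ξ α β → E_q ξ α β → Output
  m̄_q ξ α β t with incl? ξ 𝐋 | incl? ξ 𝐑 | incl? ξ 𝐌
  ... | yes _ | _     | _     = 𝐋 , ⟦ 𝐋 ⟧⁻¹ ∘ ξ , α , β
  ... | no _  | yes _ | _     = 𝐑 , ⟦ 𝐑 ⟧⁻¹ ∘ ξ , α , β
  ... | no _  | no _  | yes _ = 𝐌 , ⟦ 𝐌 ⟧⁻¹ ∘ ξ , α , β
  m̄_q ξ α β (next t)   | no _  | no _  | no _  = m̄_q (absorb ξ α β) (tl α) (tl β) t
  m̄_q ξ α β (emit 𝐋 i) | no ¬i | no _  | no _  = contradiction i ¬i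
  m̄_q ξ α β (emit 𝐑 i) | no _  | no ¬i | no _  = contradiction i ¬i
  m̄_q ξ α β (emit 𝐌 i) | no _  | no _  | no ¬i = contradiction i ¬i

  m̄_q-irrelevant : ∀ ξ α β (t t′ : E_q ξ α β) → m̄_q ξ α β t ≡ m̄_q ξ α β t′
  m̄_q-irrelevant ξ α β t t′ with incl? ξ 𝐋 | incl? ξ 𝐑 | incl? ξ 𝐌
  ... | yes _ | _     | _     = ≡.refl
  ... | no _  | yes _ | _     = ≡.refl
  ... | no _  | no _  | yes _ = ≡.refl
  m̄_q-irrelevant ξ α β (next t) (next t′)   | no _  | no _  | no _  = m̄_q-irrelevant _ _ _ t t′
  m̄_q-irrelevant ξ α β (emit 𝐋 i) _         | no ¬i | no _  | no _  = contradiction i ¬i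
  m̄_q-irrelevant ξ α β (emit 𝐑 i) _         | no _  | no ¬i | no _  = contradiction i ¬i
  m̄_q-irrelevant ξ α β (emit 𝐌 i) _         | no _  | no _  | no ¬i = contradiction i ¬i
  m̄_q-irrelevant ξ α β (next _) (emit 𝐋 i)  | no ¬i | no _  | no _  = contradiction i ¬i
  m̄_q-irrelevant ξ α β (next _) (emit 𝐑 i)  | no _  | no ¬i | no _  = contradiction i ¬i
  m̄_q-irrelevant ξ α β (next _) (emit 𝐌 i)  | no _  | no _  | no ¬i = contradiction i ¬i

  data Ψ_q : ℕ → Tensor → Digit^ω → Digit^ω → Set (c ⊔ ℓ₁ ⊔ ℓ₂) where
    base : ∀ {ξ α β} → E_q ξ α β → Ψ_q 0 ξ α β
    step : ∀ {n ξ α β φ ξ′ α′ β′} (t : E_q ξ α β) → m̄_q ξ α β t ≡ (φ , ξ′ , α′ , β′) →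
           Ψ_q n ξ′ α′ β′ → Ψ_q (1+ n) ξ α β

  P_q : Tensor → Digit^ω → Digit^ω → Set (c ⊔ ℓ₁ ⊔ ℓ₂)
  P_q ξ α β = ∀ n → Ψ_q n ξ α β

  P_q⇒E_q : ∀ {ξ α β} → P_q ξ α β → E_q ξ α β
  P_q⇒E_q p with p 0
  ... | base t = t

  P_q-next : ∀ {ξ α β φ ξ′ α′ β′} (t : E_q ξ α β) → m̄_q ξ α β t ≡ (φ , ξ′ , α′ , β′) →
             P_q ξ α β → P_q ξ′ α′ β′
  P_q-next {ξ} {α} {β} t eq p n with p (1+ n)
  ... | step t′ eq′ ψ with ≡.trans (≡.sym eq′) (≡.trans (m̄_q-irrelevant ξ α β t′ t) eq)
  ...   | ≡.refl = ψ

  q̄ : ∀ ξ α β → P_q ξ α β → Digit^ω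
  q̄ ξ α β p zero   = let (φ , _ , _ , _) = m̄_q ξ α β (P_q⇒E_q p) in φ
  q̄ ξ α β p (1+ n) = let (_ , ξ′ , α′ , β′) = m̄_q ξ α β (P_q⇒E_q p) in
                     q̄ ξ′ α′ β′ (P_q-next (P_q⇒E_q p) ≡.refl p) n

  3ᴿ : Carrier
  3ᴿ = ι (+ 3 Rat./ 1)

  opaque

    r+3#0 : ∀ {r} → r ∈[-1,1] → r + 3ᴿ # 0#
    r+3#0 {r} r∈ = #-congʳ (solve 2 (λ r u → con 1ℚ :* r :+ u := r :+ u) refl r 3ᴿ)
      (#-sym (<⇒# (affine-pos r∈
        (<-respʳ-≈ (ι-sub (+ 3 Rat./ 1) 1ℚ) (ι0<ι (from-yes (0ℚ RatP.<? (+ 2 Rat./ 1)))))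
        (<-respʳ-≈ (+-homo (+ 3 Rat./ 1) 1ℚ) (ι0<ι (from-yes (0ℚ RatP.<? (+ 4 Rat./ 1))))))))

    -r+3#0 : ∀ {r} → r ∈[-1,1] → - r + 3ᴿ # 0#
    -r+3#0 {r} r∈ = #-congʳ (solve 2 (λ r u → con -1ℚ :* r :+ u := :- r :+ u) refl r 3ᴿ)
      (#-sym (<⇒# (affine-pos r∈
        (<-respʳ-≈ (ι-sub (+ 3 Rat./ 1) -1ℚ) (ι0<ι (from-yes (0ℚ RatP.<? (+ 4 Rat./ 1)))))
        (<-respʳ-≈ (+-homo (+ 3 Rat./ 1) -1ℚ) (ι0<ι (from-yes (0ℚ RatP.<? (+ 2 Rat./ 1))))))))

    3#0 : 3ᴿ # 0#
    3#0 = #-sym (<⇒# (ι0<ι (from-yes (0ℚ RatP.<? (+ 3 Rat./ 1)))))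

  Relation : Set (suc (c ⊔ ℓ₁ ⊔ ℓ₂))
  Relation = Digit^ω → Carrier → Set (c ⊔ ℓ₁ ⊔ ℓ₂)

  data RepRule (R : Relation) (β : Digit^ω) (x : Carrier) : Set (c ⊔ ℓ₁ ⊔ ℓ₂) where
    rep-𝐋 : ∀ {α r} (r∈ : r ∈[-1,1]) → R α r → β ≅ Cons 𝐋 α →
            x ≈ (r - 1#) / (r + 3ᴿ) ⟨ r+3#0 r∈ ⟩ → RepRule R β x
    rep-𝐑 : ∀ {α r} (r∈ : r ∈[-1,1]) → R α r → β ≅ Cons 𝐑 α →
            x ≈ (r + 1#) / (- r + 3ᴿ) ⟨ -r+3#0 r∈ ⟩ → RepRule R β x
    rep-𝐌 : ∀ {α r} → r ∈[-1,1] → R α r → β ≅ Cons 𝐌 α →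
            x ≈ r / 3ᴿ ⟨ 3#0 ⟩ → RepRule R β x

  -- The greatest relation R with R ⊆ RepRule R, as the union of all of them.
  -- Real equality is the setoid equality, so the rules conclude about any x
  -- equal to the value displayed.
  rep : Digit^ω → Carrier → Set (suc (c ⊔ ℓ₁ ⊔ ℓ₂))
  rep β x = Σ[ R ∈ Relation ] (∀ {β x} → R β x → RepRule R β x) × R β x

-- The state of the algorithm after absorbing and emitting any number of digits
-- still determines the value: absorbing a digit pair replaces the arguments by
-- their tails' values, which only rescales numerator and denominator by a unit,
-- and emitting φ replaces the value by its preimage under ⟦ φ ⟧.  So the pairs
-- (stream computed from a state, value of that state) are closed backwards under
-- the rules of rep.

module Submission where

open import Defs
open import Level using (Level; _⊔_)
open import Algebra.Morphism.Structures using (module RingMorphisms)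
open import Data.Nat.Base using (zero) renaming (suc to 1+_)
open import Data.Integer.Base using (+_)
open import Data.Product.Base using (Σ-syntax; ∃-syntax; _×_; _,_; proj₁; proj₂)
open import Data.Rational.Base as Rat using (ℚ; 0ℚ; 1ℚ; ½; -½)
import Data.Rational.Properties as RatP
open import Relation.Binary.PropositionalEquality.Core as ≡ using (_≡_)
open import Relation.Nullary.Decidable.Core using (yes; no; True; toWitness)
open import Relation.Nullary.Negation.Core using (contradiction)
import Algebra.Apartness.Properties.HeytingCommutativeRing as HeytingProperties

module Correctness {c ℓ₁ ℓ₂ : Level} (ℝ : RealNumbers c ℓ₁ ℓ₂) where

  open RealNumbers ℝ
  open Exact ℝ
  open Solver using (solve; con; _:+_; _:*_; :-_; _:-_; _:=_)
  open RingMorphisms.IsRingHomomorphism ι-isRingHomomorphism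
    using (+-homo; *-homo; -‿homo; 0#-homo; 1#-homo)
    renaming (⟦⟧-cong to ι-cong)
  open HeytingProperties heytingCommutativeRing
    using (x#0y#0→xy#0; #-congʳ)

  -- Values as quotients.

  -- Division as a relation: no apartness proof occurs in the value, and facts about values become
  -- polynomial identities.
  IsQuotient : Carrier → Carrier → Carrier → Set (ℓ₁ ⊔ ℓ₂)
  IsQuotient n d x = d # 0# × d * x ≈ n

  IsValue : Tensor → Carrier → Carrier → Carrier → Set (ℓ₁ ⊔ ℓ₂)
  IsValue ξ x y = IsQuotient (numerator ξ x y) (denominator ξ x y)

  IsValueₘ : Möbius → Carrier → Carrier → Set (ℓ₁ ⊔ ℓ₂)
  IsValueₘ μ x = IsQuotient (numeratorₘ μ x) (denominatorₘ μ x)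

  opaque

    /-isQuotient : ∀ n {d} (d#0 : d # 0#) → IsQuotient n d (n / d ⟨ d#0 ⟩)
    /-isQuotient n d#0 = d#0 , /-* n d#0

    isQuotient-unique : ∀ {n d x y} → IsQuotient n d x → IsQuotient n d y → x ≈ y
    isQuotient-unique (d#0 , dx≈n) (_ , dy≈n) = *-cancelˡ-≈ d#0 (trans dx≈n (sym dy≈n))

    isQuotient-respʳ : ∀ {n d x y} → x ≈ y → IsQuotient n d x → IsQuotient n d y
    isQuotient-respʳ x≈y (d#0 , dx≈n) = d#0 , trans (*-congˡ (sym x≈y)) dx≈n

    isQuotient-expand : ∀ {k n d n′ d′ x} → k # 0# → n′ ≈ k * n → d′ ≈ k * d →
                        IsQuotient n d x → IsQuotient n′ d′ x
    isQuotient-expand {k} {x = x} k#0 n′≈ d′≈ (d#0 , dx≈n) =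
      #-congʳ (sym d′≈) (x#0y#0→xy#0 k#0 d#0) ,
      trans (*-congʳ d′≈) (trans (*-assoc k _ x) (trans (*-congˡ dx≈n) (sym n′≈)))

    -- A factor of an invertible product is invertible, so apartness of `k` and of `d` from zero
    -- both come from that of `d′`.
    isQuotient-cancel : ∀ {k n d n′ d′ x} → n′ ≈ k * n → d′ ≈ k * d →
                        IsQuotient n′ d′ x → IsQuotient n d x
    isQuotient-cancel {k} {d = d} {x = x} n′≈ d′≈ (d′#0 , d′x≈n′) =
      xy#0⇒y#0 kd#0 ,
      *-cancelˡ-≈ (xy#0⇒x#0 kd#0) (trans (sym (*-assoc k _ x)) (trans (*-congʳ (sym d′≈)) (trans d′x≈n′ n′≈)))
      where
      kd#0 : k * d # 0#
      kd#0 = #-congʳ d′≈ d′#0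

  -- Digits map [-1,1] into itself.

  opaque

    denominatorₘ-pos : ∀ φ {x} → x ∈[-1,1] → 0# < denominatorₘ ⟦ φ ⟧ x
    denominatorₘ-pos φ x∈ = affine-pos x∈ (s-r-pos φ) (s+r-pos φ)

    affine-ι-nonneg : ∀ A B {x} → x ∈[-1,1] → 0ℚ Rat.≤ B Rat.- A → 0ℚ Rat.≤ B Rat.+ A →
                      0# ≤ ι A * x + ι B
    affine-ι-nonneg A B x∈ 0≤B-A 0≤B+A = affine-nonneg x∈
      (≤-resp₂ 0#-homo (ι-sub B A) (ι-mono-≤ 0≤B-A))
      (≤-resp₂ 0#-homo (+-homo B A) (ι-mono-≤ 0≤B+A))

    ι-affine-+ : ∀ r s p q x → ι (r Rat.+ p) * x + ι (s Rat.+ q) ≈ (ι r * x + ι s) + (ι p * x + ι q)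
    ι-affine-+ r s p q x = trans (+-cong (*-congʳ (+-homo r p)) (+-homo s q))
      (solve 5 (λ r s p q x → (r :+ p) :* x :+ (s :+ q) := (r :* x :+ s) :+ (p :* x :+ q)) refl
        (ι r) (ι s) (ι p) (ι q) x)

    ι-affine-∸ : ∀ r s p q x → ι (r Rat.- p) * x + ι (s Rat.- q) ≈ (ι r * x + ι s) - (ι p * x + ι q)
    ι-affine-∸ r s p q x = trans (+-cong (*-congʳ (ι-sub r p)) (ι-sub s q))
      (solve 5 (λ r s p q x → (r :- p) :* x :+ (s :- q) := (r :* x :+ s) :- (p :* x :+ q)) refl
        (ι r) (ι s) (ι p) (ι q) x)

    -- An affine function is nonnegative on [-1,1] once it is so at both endpoints. These two
    -- rational comparisons are implicit `True` arguments, settled by evaluation for a concrete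
    -- matrix.
    ⁺-nonneg : ∀ μ → let open Möbius μ in
      {True (0ℚ RatP.≤? (s Rat.+ q) Rat.- (r Rat.+ p))} →
      {True (0ℚ RatP.≤? (s Rat.+ q) Rat.+ (r Rat.+ p))} →
      ∀ {x} → x ∈[-1,1] → 0# ≤ denominatorₘ μ x + numeratorₘ μ x
    ⁺-nonneg (möbius p q r s) {left} {right} {x} x∈ = ≤-resp₂ refl (ι-affine-+ r s p q x)
      (affine-ι-nonneg (r Rat.+ p) (s Rat.+ q) x∈ (toWitness left) (toWitness right))

    ⁻-nonneg : ∀ μ → let open Möbius μ in
      {True (0ℚ RatP.≤? (s Rat.- q) Rat.- (r Rat.- p))} →
      {True (0ℚ RatP.≤? (s Rat.- q) Rat.+ (r Rat.- p))} →
      ∀ {x} → x ∈[-1,1] → 0# ≤ denominatorₘ μ x - numeratorₘ μ x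
    ⁻-nonneg (möbius p q r s) {left} {right} {x} x∈ = ≤-resp₂ refl (ι-affine-∸ r s p q x)
      (affine-ι-nonneg (r Rat.- p) (s Rat.- q) x∈ (toWitness left) (toWitness right))

    digit⁺-nonneg : ∀ φ {x} → x ∈[-1,1] → 0# ≤ denominatorₘ ⟦ φ ⟧ x + numeratorₘ ⟦ φ ⟧ x
    digit⁺-nonneg 𝐋 = ⁺-nonneg ⟦ 𝐋 ⟧
    digit⁺-nonneg 𝐑 = ⁺-nonneg ⟦ 𝐑 ⟧
    digit⁺-nonneg 𝐌 = ⁺-nonneg ⟦ 𝐌 ⟧

    digit⁻-nonneg : ∀ φ {x} → x ∈[-1,1] → 0# ≤ denominatorₘ ⟦ φ ⟧ x - numeratorₘ ⟦ φ ⟧ x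
    digit⁻-nonneg 𝐋 = ⁻-nonneg ⟦ 𝐋 ⟧
    digit⁻-nonneg 𝐑 = ⁻-nonneg ⟦ 𝐑 ⟧
    digit⁻-nonneg 𝐌 = ⁻-nonneg ⟦ 𝐌 ⟧

    -- Multiplying 1 + x and 1 - x by the positive denominator w gives w + v and w - v, where v is
    -- the numerator.
    digit-∈ : ∀ φ {z x} → z ∈[-1,1] → IsValueₘ ⟦ φ ⟧ z x → x ∈[-1,1]
    digit-∈ φ {z} {x} z∈ (_ , wx≈v) = ∈-intro
      (*-cancelˡ-nonneg 0<w (≤-resp₂ refl
        (trans (+-congˡ (sym wx≈v)) (solve 2 (λ w x → w :+ w :* x := w :* (con 1ℚ :+ x)) refl _ x))
        (digit⁺-nonneg φ z∈)))
      (*-cancelˡ-nonneg 0<w (≤-resp₂ refl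
        (trans (+-congˡ (-‿cong (sym wx≈v))) (solve 2 (λ w x → w :- w :* x := w :* (con 1ℚ :- x)) refl _ x))
        (digit⁻-nonneg φ z∈)))
      where
      0<w : 0# < denominatorₘ ⟦ φ ⟧ z
      0<w = denominatorₘ-pos φ z∈

  -- Absorbing a digit.

  opaque

    ⟪•₁⟫-solve : ∀ a b c d p q r s x y {X} → (r * x + s) * X ≈ p * x + q →
      (a * p + c * r) * x * y + (b * p + d * r) * x + (a * q + c * s) * y + (b * q + d * s)
      ≈ (r * x + s) * (a * X * y + b * X + c * y + d)
    ⟪•₁⟫-solve a b c d p q r s x y {X} eq = trans
      (solve 10 (λ a b c d p q r s x y →
        (a :* p :+ c :* r) :* x :* y :+ (b :* p :+ d :* r) :* x :+ (a :* q :+ c :* s) :* y :+ (b :* q :+ d :* s)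
        := (a :* y :+ b) :* (p :* x :+ q) :+ (c :* y :+ d) :* (r :* x :+ s)) refl a b c d p q r s x y)
      -- The form is now linear in the pair (p x + q, r x + s), and p x + q is (r x + s) X.
      (trans (+-congʳ (*-congˡ (sym eq)))
        (solve 7 (λ a b c d w y X → (a :* y :+ b) :* (w :* X) :+ (c :* y :+ d) :* w
          := w :* (a :* X :* y :+ b :* X :+ c :* y :+ d)) refl a b c d (r * x + s) y X))

    ⟪•₂⟫-solve : ∀ a b c d p q r s x y {Y} → (r * y + s) * Y ≈ p * y + q →
      (a * p + b * r) * x * y + (a * q + b * s) * x + (c * p + d * r) * y + (c * q + d * s)
      ≈ (r * y + s) * (a * x * Y + b * x + c * Y + d)
    ⟪•₂⟫-solve a b c d p q r s x y {Y} eq = trans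
      (solve 10 (λ a b c d p q r s x y →
        (a :* p :+ b :* r) :* x :* y :+ (a :* q :+ b :* s) :* x :+ (c :* p :+ d :* r) :* y :+ (c :* q :+ d :* s)
        := (a :* x :+ c) :* (p :* y :+ q) :+ (b :* x :+ d) :* (r :* y :+ s)) refl a b c d p q r s x y)
      (trans (+-congʳ (*-congˡ (sym eq)))
        (solve 7 (λ a b c d w x Y → (a :* x :+ c) :* (w :* Y) :+ (b :* x :+ d) :* w
          := w :* (a :* x :* Y :+ b :* x :+ c :* Y :+ d)) refl a b c d (r * y + s) x Y))

    ⟪⟫-cong : ∀ a b c d {a′ b′ c′ d′} x y → ι a ≈ a′ → ι b ≈ b′ → ι c ≈ c′ → ι d ≈ d′ →
              ⟪ row a b c d ⟫ x y ≈ a′ * x * y + b′ * x + c′ * y + d′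
    ⟪⟫-cong a b c d x y a≈ b≈ c≈ d≈ =
      +-cong (+-cong (+-cong (*-congʳ (*-congʳ a≈)) (*-congʳ b≈)) (*-congʳ c≈)) d≈

    -- Both rows acquire the same factor, the denominator of `μ` at `x`, which cancels. The
    -- direction is from the absorbed tensor back to `ξ`, so apartness of the denominator is pulled
    -- back too.
    •₁-value : ∀ ξ μ {x X y z} → IsValueₘ μ x X → IsValue (ξ •₁ μ) x y z → IsValue ξ X y z
    •₁-value (tensor (row n₁ n₂ n₃ n₄) (row d₁ d₂ d₃ d₄)) μ {x} {X} {y} (_ , wX≈v) =
      isQuotient-cancel {k = denominatorₘ μ x} (expand n₁ n₂ n₃ n₄) (expand d₁ d₂ d₃ d₄)
      where
      open Möbius μ
      expand : ∀ a b c d →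
        ⟪ row (a Rat.* p Rat.+ c Rat.* r) (b Rat.* p Rat.+ d Rat.* r)
              (a Rat.* q Rat.+ c Rat.* s) (b Rat.* q Rat.+ d Rat.* s) ⟫ x y
        ≈ denominatorₘ μ x * ⟪ row a b c d ⟫ X y
      expand a b c d = trans
        (⟪⟫-cong _ _ _ _ x y (ι-lin a p c r) (ι-lin b p d r) (ι-lin a q c s) (ι-lin b q d s))
        (⟪•₁⟫-solve (ι a) (ι b) (ι c) (ι d) (ι p) (ι q) (ι r) (ι s) x y wX≈v)

    •₂-value : ∀ ξ μ {x y Y z} → IsValueₘ μ y Y → IsValue (ξ •₂ μ) x y z → IsValue ξ x Y z
    •₂-value (tensor (row n₁ n₂ n₃ n₄) (row d₁ d₂ d₃ d₄)) μ {x} {y} {Y} (_ , wY≈v) =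
      isQuotient-cancel {k = denominatorₘ μ y} (expand n₁ n₂ n₃ n₄) (expand d₁ d₂ d₃ d₄)
      where
      open Möbius μ
      expand : ∀ a b c d →
        ⟪ row (a Rat.* p Rat.+ b Rat.* r) (a Rat.* q Rat.+ b Rat.* s)
              (c Rat.* p Rat.+ d Rat.* r) (c Rat.* q Rat.+ d Rat.* s) ⟫ x y
        ≈ denominatorₘ μ y * ⟪ row a b c d ⟫ x Y
      expand a b c d = trans
        (⟪⟫-cong _ _ _ _ x y (ι-lin a p b r) (ι-lin a q b s) (ι-lin c p d r) (ι-lin c q d s))
        (⟪•₂⟫-solve (ι a) (ι b) (ι c) (ι d) (ι p) (ι q) (ι r) (ι s) x y wY≈v)

  -- Emitting a digit.

  opaque

    ι#0 : ∀ {k l} → k Rat.* l ≡ 1ℚ → ι k # 0#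
    ι#0 {k} {l} kl≡1 = xy#0⇒x#0 (#-congʳ (trans (sym (ι-cong kl≡1)) (*-homo k l)) (#-sym (<⇒# 0<ι1)))

    -- Solving μ(z) = N / D for z gives (s N - q D) / (p D - r N), the adjugate of `μ` applied to
    -- (N, D). The inverse matrix only adds the factor 1 / det to both rows.
    inverse-value : ∀ μ .{{_ : Rat.NonZero (det μ)}} ξ {x y z w} →
      let open Möbius μ in 0# < ι p * ι s - ι q * ι r →
      IsValue ξ x y w → IsValueₘ μ z w → IsValue (inverse μ ∘ ξ) x y z
    inverse-value μ (tensor n d) {x} {y} {z} {w} 0<det (D#0 , Dw≈N) (m#0 , mw≈v) =
      isQuotient-expand {k = ι k} {n = ι s * N - ι q * D} {d = ι p * D - ι r * N}
        (ι#0 (RatP.*-inverseˡ (det μ)))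
        (trans (⟪lin⟫ (k Rat.* s) n (k Rat.* (Rat.- q)) d x y) (trans
          (+-cong (*-congʳ (*-homo k s)) (*-congʳ (trans (*-homo k _) (*-congˡ (-‿homo q)))))
          (solve 5 (λ k s q N D → (k :* s) :* N :+ (k :* (:- q)) :* D := k :* (s :* N :- q :* D))
            refl (ι k) (ι s) (ι q) N D)))
        (trans (⟪lin⟫ (k Rat.* (Rat.- r)) n (k Rat.* p) d x y) (trans
          (+-cong (*-congʳ (trans (*-homo k _) (*-congˡ (-‿homo r)))) (*-congʳ (*-homo k p)))
          (solve 5 (λ k p r N D → (k :* (:- r)) :* N :+ (k :* p) :* D := k :* (p :* D :- r :* N))
            refl (ι k) (ι p) (ι r) N D)))
        -- m (p D - r N) = det D is apart from zero, hence so is its factor p D - r N.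
        (xy#0⇒y#0 (#-congʳ (sym mE) (x#0y#0→xy#0 (#-sym (<⇒# 0<det)) D#0)) ,
         *-cancelˡ-≈ m#0 (trans (sym (*-assoc _ _ z)) (trans (*-congʳ mE) (sym mS))))
      where
      open Möbius μ
      open Criterion μ n d using (E-identity; S-identity)

      k : ℚ
      k = Rat.1/ det μ

      N D m : Carrier
      N = ⟪ n ⟫ x y
      D = ⟪ d ⟫ x y
      m = denominatorₘ μ z

      cross : N * m ≈ numeratorₘ μ z * D
      cross = trans (*-congʳ (sym Dw≈N)) (trans
        (solve 3 (λ D w m → (D :* w) :* m := (m :* w) :* D) refl D w m) (*-congʳ mw≈v))

      mE : m * (ι p * D - ι r * N) ≈ (ι p * ι s - ι q * ι r) * D
      mE = E-identity refl cross

      mS : m * (ι s * N - ι q * D) ≈ (ι p * ι s - ι q * ι r) * D * z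
      mS = S-identity refl cross

    digit⁻¹-value : ∀ φ ξ {x y z w} → IsValue ξ x y w → IsValueₘ ⟦ φ ⟧ z w → IsValue (⟦ φ ⟧⁻¹ ∘ ξ) x y z
    digit⁻¹-value 𝐋 ξ = inverse-value ⟦ 𝐋 ⟧ ξ (det-pos 𝐋)
    digit⁻¹-value 𝐑 ξ = inverse-value ⟦ 𝐑 ⟧ ξ (det-pos 𝐑)
    digit⁻¹-value 𝐌 ξ = inverse-value ⟦ 𝐌 ⟧ ξ (det-pos 𝐌)

  -- The rules of `rep`, uniformly in the digit.

  -- The three rules as one, with the digit as a field, so that later arguments need no case split
  -- on it.
  record DigitRule (R : Relation) (β : Digit^ω) (x : Carrier) : Set (c ⊔ ℓ₁ ⊔ ℓ₂) where
    constructor digitRule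
    field
      {φ}     : Digit
      {α}     : Digit^ω
      {r}     : Carrier
      r∈      : r ∈[-1,1]
      related : R α r
      β≅      : β ≅ Cons φ α
      x-value : IsValueₘ ⟦ φ ⟧ r x

  -- rep writes 𝐋 and 𝐑 without the common factor ½ of the entries of ⟦ 𝐋 ⟧ and ⟦ 𝐑 ⟧.
  scale : Digit → ℚ
  scale 𝐋 = ½
  scale 𝐑 = ½
  scale 𝐌 = 1ℚ

  ruleNumerator ruleDenominator : Digit → Carrier → Carrier
  ruleNumerator 𝐋 r = r - 1#
  ruleNumerator 𝐑 r = r + 1#
  ruleNumerator 𝐌 r = r
  ruleDenominator 𝐋 r = r + 3ᴿ
  ruleDenominator 𝐑 r = - r + 3ᴿ
  ruleDenominator 𝐌 r = 3ᴿ

  opaque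

    scale#0 : ∀ φ → ι (scale φ) # 0#
    scale#0 𝐋 = ι#0 {½} {+ 2 Rat./ 1} ≡.refl
    scale#0 𝐑 = ι#0 {½} {+ 2 Rat./ 1} ≡.refl
    scale#0 𝐌 = ι#0 {1ℚ} {1ℚ} ≡.refl

    numeratorₘ-scale : ∀ φ r → numeratorₘ ⟦ φ ⟧ r ≈ ι (scale φ) * ruleNumerator φ r
    numeratorₘ-scale 𝐋 r = trans
      (solve 1 (λ r → con ½ :* r :+ con -½ := con ½ :* (r :- con 1ℚ)) refl r)
      (*-congˡ (+-congˡ (-‿cong 1#-homo)))
    numeratorₘ-scale 𝐑 r = trans
      (solve 1 (λ r → con ½ :* r :+ con ½ := con ½ :* (r :+ con 1ℚ)) refl r)
      (*-congˡ (+-congˡ 1#-homo))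
    numeratorₘ-scale 𝐌 = solve 1 (λ r → con 1ℚ :* r :+ con 0ℚ := con 1ℚ :* r) refl

    denominatorₘ-scale : ∀ φ r → denominatorₘ ⟦ φ ⟧ r ≈ ι (scale φ) * ruleDenominator φ r
    denominatorₘ-scale 𝐋 =
      solve 1 (λ r → con ½ :* r :+ con (+ 3 Rat./ 2) := con ½ :* (r :+ con (+ 3 Rat./ 1))) refl
    denominatorₘ-scale 𝐑 =
      solve 1 (λ r → con -½ :* r :+ con (+ 3 Rat./ 2) := con ½ :* (:- r :+ con (+ 3 Rat./ 1))) refl
    denominatorₘ-scale 𝐌 =
      solve 1 (λ r → con 0ℚ :* r :+ con (+ 3 Rat./ 1) := con 1ℚ :* con (+ 3 Rat./ 1)) refl

    rule⇒valueₘ : ∀ φ {r x} → IsQuotient (ruleNumerator φ r) (ruleDenominator φ r) x → IsValueₘ ⟦ φ ⟧ r x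
    rule⇒valueₘ φ {r} = isQuotient-expand (scale#0 φ) (numeratorₘ-scale φ r) (denominatorₘ-scale φ r)

    valueₘ⇒rule : ∀ φ {r x} → IsValueₘ ⟦ φ ⟧ r x → IsQuotient (ruleNumerator φ r) (ruleDenominator φ r) x
    valueₘ⇒rule φ {r} = isQuotient-cancel (numeratorₘ-scale φ r) (denominatorₘ-scale φ r)

    /⇒valueₘ : ∀ φ {r x} (nz : ruleDenominator φ r # 0#) →
      x ≈ ruleNumerator φ r / ruleDenominator φ r ⟨ nz ⟩ → IsValueₘ ⟦ φ ⟧ r x
    /⇒valueₘ φ nz x≈ = rule⇒valueₘ φ (isQuotient-respʳ (sym x≈) (/-isQuotient _ nz))

    valueₘ⇒/ : ∀ φ {r x} (nz : ruleDenominator φ r # 0#) →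
      IsValueₘ ⟦ φ ⟧ r x → x ≈ ruleNumerator φ r / ruleDenominator φ r ⟨ nz ⟩
    valueₘ⇒/ φ nz v = isQuotient-unique (valueₘ⇒rule φ v) (/-isQuotient _ nz)

    repRule⇒digitRule : ∀ {R β x} → RepRule R β x → DigitRule R β x
    repRule⇒digitRule (rep-𝐋 r∈ ρ β≅ x≈) = digitRule r∈ ρ β≅ (/⇒valueₘ 𝐋 (r+3#0 r∈) x≈)
    repRule⇒digitRule (rep-𝐑 r∈ ρ β≅ x≈) = digitRule r∈ ρ β≅ (/⇒valueₘ 𝐑 (-r+3#0 r∈) x≈)
    repRule⇒digitRule (rep-𝐌 r∈ ρ β≅ x≈) = digitRule r∈ ρ β≅ (/⇒valueₘ 𝐌 3#0 x≈)

    digitRule⇒repRule : ∀ {R β x} → DigitRule R β x → RepRule R β x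
    digitRule⇒repRule (digitRule {𝐋} r∈ ρ β≅ v) = rep-𝐋 r∈ ρ β≅ (valueₘ⇒/ 𝐋 (r+3#0 r∈) v)
    digitRule⇒repRule (digitRule {𝐑} r∈ ρ β≅ v) = rep-𝐑 r∈ ρ β≅ (valueₘ⇒/ 𝐑 (-r+3#0 r∈) v)
    digitRule⇒repRule (digitRule {𝐌} r∈ ρ β≅ v) = rep-𝐌 r∈ ρ β≅ (valueₘ⇒/ 𝐌 3#0 v)

  -- A post-fixed point of RepRule need not respect ≅, so tl α is related only up to ≅.
  _⟨≅⟩_ : Digit^ω → Relation → Carrier → Set (c ⊔ ℓ₁ ⊔ ℓ₂)
  (α ⟨≅⟩ R) r = ∃[ α₀ ] α ≅ α₀ × R α₀ r

  PostFixed : Relation → Set (c ⊔ ℓ₁ ⊔ ℓ₂)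
  PostFixed R = ∀ {β x} → R β x → RepRule R β x

  -- Reading one digit of an input.

  module _ {R : Relation} (R⊆ : PostFixed R) where

    opaque

      -- The two bisimilarities compose: entry 0 identifies the digit of the rule with `hd α`, the
      -- later entries give the tail.
      unfold : ∀ {α r} → (α ⟨≅⟩ R) r →
        ∃[ r′ ] r′ ∈[-1,1] × (tl α ⟨≅⟩ R) r′ × IsValueₘ ⟦ hd α ⟧ r′ r
      unfold {α} (α₀ , α≅ , ρ) with repRule⇒digitRule (R⊆ ρ)
      ... | digitRule {r = r′} r′∈ ρ′ α₀≅ v = r′ , r′∈ ,
        (_ , (λ n → ≡.trans (α≅ (1+ n)) (α₀≅ (1+ n))) , ρ′) ,
        ≡.subst (λ φ → IsValueₘ ⟦ φ ⟧ r′ _) (≡.sym (≡.trans (α≅ 0) (α₀≅ 0))) v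

      -- Puts the inputs in the square, the only place where `Incl` says anything.
      related⇒∈ : ∀ {α r} → (α ⟨≅⟩ R) r → r ∈[-1,1]
      related⇒∈ {α} ρ = let (_ , r′∈ , _ , v) = unfold ρ in digit-∈ (hd α) r′∈ v

  -- Correctness of one output digit, and the coinduction.

  module _ {R₁ R₂ : Relation} (R₁⊆ : PostFixed R₁) (R₂⊆ : PostFixed R₂) where

    -- The value `x` is a field because its existence, with the denominator of `ξ` apart from zero,
    -- is itself an outcome of the recursion.
    record Emission (ξ : Tensor) (r₁ r₂ : Carrier) (o : Output) : Set (c ⊔ ℓ₁ ⊔ ℓ₂) where
      constructor emission
      private
        φ  = proj₁ o
        ξ′ = proj₁ (proj₂ o)
        α′ = proj₁ (proj₂ (proj₂ o))
        β′ = proj₂ (proj₂ (proj₂ o))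
      field
        {x z r₁′ r₂′} : Carrier
        z∈            : z ∈[-1,1]
        ρ₁            : (α′ ⟨≅⟩ R₁) r₁′
        ρ₂            : (β′ ⟨≅⟩ R₂) r₂′
        x-value       : IsValue ξ r₁ r₂ x
        x-digit       : IsValueₘ ⟦ φ ⟧ z x
        z-value       : IsValue ξ′ r₁′ r₂′ z

    opaque

      -- `Incl` supplies a point `z` of [-1,1] that the digit sends to the value of `ξ`; the inverse
      -- digit recovers it as the value of the new tensor.
      emit-correct : ∀ φ {ξ α β r₁ r₂} → Incl ξ φ → (α ⟨≅⟩ R₁) r₁ → (β ⟨≅⟩ R₂) r₂ →
        Emission ξ r₁ r₂ (φ , ⟦ φ ⟧⁻¹ ∘ ξ , α , β)
      emit-correct φ {ξ} {r₁ = r₁} {r₂} (bounded , image) ρ₁ ρ₂ =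
        let r₁∈ = related⇒∈ R₁⊆ ρ₁
            r₂∈ = related⇒∈ R₂⊆ ρ₂
            (z , z∈ , nz , x≈) = image r₁∈ r₂∈
            x-value = /-isQuotient (numerator ξ r₁ r₂) (bounded r₁∈ r₂∈)
            x-digit = isQuotient-respʳ (sym x≈) (/-isQuotient (numeratorₘ ⟦ φ ⟧ z) nz)
        in emission z∈ ρ₁ ρ₂ x-value x-digit (digit⁻¹-value φ ξ x-value x-digit)

      -- Induction on `t`, with the case split of `m̄_q` so that its result reduces in each clause.
      m̄_q-correct : ∀ {ξ α β r₁ r₂} (t : E_q ξ α β) → (α ⟨≅⟩ R₁) r₁ → (β ⟨≅⟩ R₂) r₂ →
        Emission ξ r₁ r₂ (m̄_q ξ α β t)
      m̄_q-correct {ξ} t ρ₁ ρ₂ with incl? ξ 𝐋 | incl? ξ 𝐑 | incl? ξ 𝐌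
      ... | yes i | _     | _     = emit-correct 𝐋 i ρ₁ ρ₂
      ... | no _  | yes i | _     = emit-correct 𝐑 i ρ₁ ρ₂
      ... | no _  | no _  | yes i = emit-correct 𝐌 i ρ₁ ρ₂
      m̄_q-correct (emit 𝐋 i) _ _ | no ¬i | no _  | no _  = contradiction i ¬i
      m̄_q-correct (emit 𝐑 i) _ _ | no _  | no ¬i | no _  = contradiction i ¬i
      m̄_q-correct (emit 𝐌 i) _ _ | no _  | no _  | no ¬i = contradiction i ¬i
      m̄_q-correct {ξ} {α} {β} (next t) ρ₁ ρ₂ | no _ | no _ | no _ =
        let (_ , _ , ρ₁′ , v₁) = unfold R₁⊆ ρ₁
            (_ , _ , ρ₂′ , v₂) = unfold R₂⊆ ρ₂
            emission z∈ ρ₁″ ρ₂″ v w v′ = m̄_q-correct t ρ₁′ ρ₂′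
        -- `absorb` applies `•₂` last, so it is undone first.
        in emission z∈ ρ₁″ ρ₂″ (•₁-value ξ ⟦ hd α ⟧ v₁ (•₂-value (ξ •₁ ⟦ hd α ⟧) ⟦ hd β ⟧ v₂ v)) w v′

    -- The relation that witnesses `rep` for the output. It is built over fixed `R₁` and `R₂`
    -- because `rep` itself lies one universe above what `Relation` admits.
    record Computes (γ : Digit^ω) (x : Carrier) : Set (c ⊔ ℓ₁ ⊔ ℓ₂) where
      constructor computes
      field
        {ξ}        : Tensor
        {α β}      : Digit^ω
        {r₁ r₂}    : Carrier
        productive : P_q ξ α β
        γ≅         : γ ≅ q̄ ξ α β productive
        ρ₁         : (α ⟨≅⟩ R₁) r₁
        ρ₂         : (β ⟨≅⟩ R₂) r₂
        x-value    : IsValue ξ r₁ r₂ x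

    Computes-postFixed : PostFixed Computes
    Computes-postFixed (computes {ξ} {α} {β} p γ≅ ρ₁ ρ₂ x-value) =
      digitRule⇒repRule (digitRule E.z∈
        (computes (P_q-next (P_q⇒E_q p) ≡.refl p) (λ _ → ≡.refl) E.ρ₁ E.ρ₂ E.z-value)
        -- `q̄` reduces only at a constructor of the index; each case is then definitional.
        (λ { zero → γ≅ 0 ; (1+ n) → γ≅ (1+ n) })
        -- The value found by the recursion and the given one are quotients of the same pair, hence
        -- equal.
        (isQuotient-respʳ (isQuotient-unique E.x-value x-value) E.x-digit))
      where
      module E = Emission (m̄_q-correct (P_q⇒E_q p) ρ₁ ρ₂)

    -- `ξ` need not be bounded, but finitely many absorptions reach a bounded tensor, whose
    -- apartness is pulled back.
    denominator#0 : ∀ {ξ α β r₁ r₂} → E_q ξ α β → (α ⟨≅⟩ R₁) r₁ → (β ⟨≅⟩ R₂) r₂ →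
      denominator ξ r₁ r₂ # 0#
    denominator#0 t ρ₁ ρ₂ = proj₁ (Emission.x-value (m̄_q-correct t ρ₁ ρ₂))

theorem5p8 : {c ℓ₁ ℓ₂ : Level} (ℝ : RealNumbers c ℓ₁ ℓ₂) →
    let open RealNumbers ℝ
        open Exact ℝ
    in (ξ : Tensor) (α β : Digit^ω) (r₁ r₂ : Carrier) (p : P_q ξ α β) →
       rep α r₁ → rep β r₂ →
       Σ[ nz ∈ denominator ξ r₁ r₂ # 0# ] rep (q̄ ξ α β p) (apply ξ r₁ r₂ nz)
theorem5p8 ℝ ξ α β r₁ r₂ p (R₁ , R₁⊆ , α∼r₁) (R₂ , R₂⊆ , β∼r₂) =
  nz , Computes R₁⊆ R₂⊆ , Computes-postFixed R₁⊆ R₂⊆ ,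
  computes p (λ _ → ≡.refl) ρ₁ ρ₂ (/-isQuotient _ nz)
  where
  open Exact ℝ using (P_q⇒E_q)
  open Correctness ℝ
  ρ₁ = α , (λ _ → ≡.refl) , α∼r₁
  ρ₂ = β , (λ _ → ≡.refl) , β∼r₂
  nz = denominator#0 R₁⊆ R₂⊆ (P_q⇒E_q p) ρ₁ ρ₂
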